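{- Let $p$ be a prime and $N$ a positive integer not divisible by $p$. For all integers $\alpha\ge1$ and $n\ge0$, $$c\phi_{p^\alpha N}(n)\equiv c\phi_{p^{\alpha-1}N}(n/p)\pmod{p^{2\alpha}};$$ equivalently, $c\phi_{p^\alpha N}(pn+r)\equiv0\pmod{p^{2\alpha}}$ for $1\le r\le p-1$, and $c\phi_{p^\alpha N}(pn)\equiv c\phi_{p^{\alpha-1}N}(n)\pmod{p^{2\alpha}}$.
   Context: A $k$-colored generalized Frobenius symbol is a two-row array with $d\ge 0$ columns whose entries are colored nonnegative integers $\ell_c$ ($\ell\ge 0$, color $c\in\{1,\dots,k\}$), each row strictly decreasing with respect to the total order $0_1\prec 0_2\prec\cdots\prec 0_k\prec 1_1\prec\cdots\prec 1_k\prec 2_1\prec\cdots$. It is a $k$-colored generalized Frobenius partition of $n=d+\sum(\text{integer values of all entries})$; $c\phi_k(n)$ is the number of such partitions of $n$ (with $c\phi_k(0)=1$), and by convention $c\phi_k(x)=0$ if $x$ is not an integer. For $k=1$, $c\phi_1(n)=p(n)$, the ordinary partition function. -}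

module Defs where

open import Data.Nat using (ℕ; _+_; _<_)
open import Data.Fin using (Fin)
import Data.Fin as Fin
open import Data.Product using (Σ; _×_; proj₁)
open import Data.Sum using (_⊎_)
open import Data.List using (List; length; map)
open import Data.Nat.ListAction using (sum)
open import Data.List.Relation.Unary.Linked using (Linked)
open import Relation.Binary.PropositionalEquality using (_≡_)

-- A k-colored nonnegative integer ℓ_c : value ℓ, color c ∈ Fin k
-- (Fin k = {0,…,k-1} stands for the colors {1,…,k}).
CNat : ℕ → Set
CNat k = ℕ × Fin k

value : ∀ {k} → CNat k → ℕ
value = proj₁

_≺_ : ∀ {k} → CNat k → CNat k → Set
(ℓ Data.Product., c) ≺ (ℓ' Data.Product., c') = (ℓ < ℓ') ⊎ ((ℓ ≡ ℓ') × (c Fin.< c'))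

StrictlyDecreasing : ∀ {k} → List (CNat k) → Set
StrictlyDecreasing = Linked (λ x y → y ≺ x)

record FrobSymbol (k : ℕ) : Set where
  constructor frob
  field
    top    : List (CNat k)
    bottom : List (CNat k)
    sameLength : length top ≡ length bottom
    topDec     : StrictlyDecreasing top
    bottomDec  : StrictlyDecreasing bottom

open FrobSymbol public

weight : ∀ {k} → FrobSymbol k → ℕ
weight s = length (top s) + (sum (map value (top s)) + sum (map value (bottom s)))

CPhi : ℕ → ℕ → Set
CPhi k n = Σ (FrobSymbol k) (λ s → weight s ≡ n)

module Submission where

-- A row of k colours with e_v entries of value v can be coloured in ∏_v (k choose e_v) ways, so cφ_k(n)
-- is the sum, over d + i + j = n, of A(d,i) A(d,j), where A(d,i) is the sum of these products over the
-- rows with d entries and value sum i.  Let k = p^α N and ε = (−1)^(p−1).  Then p^α divides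
-- (k choose e) when p ∤ e, and (k choose pe) ≡ ε^e (k/p choose e) modulo p^(2α), or modulo 2^(2α−1) when
-- p = 2 and e is odd.  If p ∤ d, both A(d,i) and A(d,j) are divisible by p^α.  If p ∣ d and some e_v is not
-- divisible by p, then so is a second one, and the product of binomials is divisible by p^(2α); hence
-- A(d,i) is, up to the sign ε^(d/p), congruent to the corresponding sum for k/p colours.  The sign cancels
-- in A(d,i) A(d,j), and for p = 2 the factor 2 that is missing from the modulus is recovered from the
-- symmetry i ↔ j.

-- Binomial coefficients modulo powers of a prime

module Binomials where

  open import Data.Nat.Base as ℕ using (ℕ; zero; suc)
  import Data.Nat.Properties as ℕₚ
  import Data.Nat.Divisibility as ℕᵈ
  open import Data.Nat.Primality using (Prime; euclidsLemma)
  open import Data.Nat.Combinatorics using (_C_; nCn≡1; nCk+nC[k+1]≡[n+1]C[k+1])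
  open import Data.Integer.Base hiding (suc; pred)
  open import Data.Integer.Properties hiding (suc-+; pred-suc)
  open import Data.Integer.Divisibility.Signed
  open import Data.Integer.Tactic.RingSolver using (solve-∀)
  open import Data.Sum using (inj₁; inj₂)
  open import Relation.Nullary using (¬_; contradiction)
  open import Relation.Binary.PropositionalEquality

  pascal : ∀ n k → + (suc n C suc k) ≡ + (n C k) + + (n C suc k)
  pascal n k = cong +_ (sym (nCk+nC[k+1]≡[n+1]C[k+1] n k))

  -- Induction by Pascal's rule. Over the integers n - e is a true difference, so the case e > n,
  -- where both binomials vanish, is covered.
  nCk-upper : ∀ n e → + suc e * + (n C suc e) ≡ (+ n - + e) * + (n C e)
  nCk-upper zero zero = refl
  nCk-upper zero (suc e) = trans (*-zeroʳ (+ suc (suc e))) (sym (*-zeroʳ (+ 0 - + suc e)))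
  nCk-upper (suc n) zero = begin
    + 1 * + (suc n C 1)                ≡⟨ cong (+ 1 *_) (pascal n 0) ⟩
    + 1 * (+ 1 + + (n C 1))            ≡⟨ *-distribˡ-+ (+ 1) (+ 1) (+ (n C 1)) ⟩
    + 1 + + 1 * + (n C 1)              ≡⟨ cong (λ z → + 1 + z) (nCk-upper n zero) ⟩
    + 1 + (+ n - + 0) * + 1            ≡⟨ lemma (+ n) ⟩
    (+ 1 + + n - + 0) * + 1            ∎
    where
    open ≡-Reasoning
    lemma : ∀ x → + 1 + (x - + 0) * + 1 ≡ (+ 1 + x - + 0) * + 1
    lemma = solve-∀
  nCk-upper (suc n) (suc f) = begin
    + suc (suc f) * + (suc n C suc (suc f))
      ≡⟨ cong (+ suc (suc f) *_) (pascal n (suc f)) ⟩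
    + suc (suc f) * (y + z)
      ≡⟨ *-distribˡ-+ (+ suc (suc f)) y z ⟩
    + suc (suc f) * y + + suc (suc f) * z
      ≡⟨ cong (λ w → + suc (suc f) * y + w) (nCk-upper n (suc f)) ⟩
    (+ 2 + + f) * y + (+ n - (+ 1 + + f)) * y
      ≡⟨ lemma₁ (+ n) (+ f) y ⟩
    (+ 1 + + f) * y + (+ n - + f) * y
      ≡⟨ cong (λ w → w + (+ n - + f) * y) (nCk-upper n f) ⟩
    (+ n - + f) * x + (+ n - + f) * y
      ≡⟨ lemma₂ (+ n) (+ f) x y ⟩
    (+ 1 + + n - (+ 1 + + f)) * (x + y)
      ≡⟨ cong ((+ suc n - + suc f) *_) (pascal n f) ⟨
    (+ suc n - + suc f) * + (suc n C suc f) ∎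
    where
    open ≡-Reasoning
    x y z : ℤ
    x = + (n C f)
    y = + (n C suc f)
    z = + (n C suc (suc f))
    lemma₁ : ∀ n f y → (+ 2 + f) * y + (n - (+ 1 + f)) * y ≡ (+ 1 + f) * y + (n - f) * y
    lemma₁ = solve-∀
    lemma₂ : ∀ n f x y → (n - f) * x + (n - f) * y ≡ (+ 1 + n - (+ 1 + f)) * (x + y)
    lemma₂ = solve-∀

  -- At n = 0, where `pred` gives 0, the factor n makes the right side vanish.
  nCk-absorb : ∀ n e → + suc e * + (n C suc e) ≡ + n * + (ℕ.pred n C e)
  nCk-absorb zero e = *-zeroʳ (+ suc e)
  nCk-absorb (suc n) e = begin
    + suc e * + (suc n C suc e)                  ≡⟨ cong (+ suc e *_) (pascal n e) ⟩
    + suc e * (x + + (n C suc e))                ≡⟨ *-distribˡ-+ (+ suc e) x (+ (n C suc e)) ⟩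
    + suc e * x + + suc e * + (n C suc e)        ≡⟨ cong (λ z → + suc e * x + z) (nCk-upper n e) ⟩
    (+ 1 + + e) * x + (+ n - + e) * x            ≡⟨ lemma (+ n) (+ e) x ⟩
    + suc n * x                                  ∎
    where
    open ≡-Reasoning
    x = + (n C e)
    lemma : ∀ n e x → (+ 1 + e) * x + (n - e) * x ≡ (+ 1 + n) * x
    lemma = solve-∀

  nCk-lower : ∀ n e → (+ n - + e) * + (n C e) ≡ + n * + (ℕ.pred n C e)
  nCk-lower n e = trans (sym (nCk-upper n e)) (nCk-absorb n e)

  *-pres-∣ : ∀ {A B x y} → A ∣ x → B ∣ y → A * B ∣ x * y
  *-pres-∣ {A} {B} {x} {y} h g = ∣-trans (*-monoʳ-∣ A g) (*-monoˡ-∣ y h)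

  pos-^-+ : ∀ p s t → + (p ℕ.^ (s ℕ.+ t)) ≡ + (p ℕ.^ s) * + (p ℕ.^ t)
  pos-^-+ p s t = trans (cong +_ (ℕₚ.^-distribˡ-+-* p s t)) (pos-* (p ℕ.^ s) (p ℕ.^ t))

  -- Integer polynomials and their difference quotients

  data Poly : Set where
    con     : ℤ → Poly
    var     : Poly
    _⊕_ _⊗_ : Poly → Poly → Poly

  ⟦_⟧ : Poly → ℤ → ℤ
  ⟦ con c ⟧ x = c
  ⟦ var   ⟧ x = x
  ⟦ f ⊕ g ⟧ x = ⟦ f ⟧ x + ⟦ g ⟧ x
  ⟦ f ⊗ g ⟧ x = ⟦ f ⟧ x * ⟦ g ⟧ x

  -- The difference quotient (f(X) - f(a)) / (X - a), obtained from a product rule by recursion on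
  -- the syntax; this is why polynomials are syntax trees and not functions.
  quot : ℤ → Poly → Poly
  quot a (con c) = con 0ℤ
  quot a var     = con 1ℤ
  quot a (f ⊕ g) = quot a f ⊕ quot a g
  quot a (f ⊗ g) = (quot a f ⊗ g) ⊕ (con (⟦ f ⟧ a) ⊗ quot a g)

  factor : ∀ a f x → ⟦ f ⟧ x - ⟦ f ⟧ a ≡ (x - a) * ⟦ quot a f ⟧ x
  factor a (con c) x = trans (+-inverseʳ c) (sym (*-zeroʳ (x - a)))
  factor a var     x = sym (*-identityʳ (x - a))
  factor a (f ⊕ g) x = trans (lemma (⟦ f ⟧ x) (⟦ g ⟧ x) (⟦ f ⟧ a) (⟦ g ⟧ a))
    (trans (cong₂ _+_ (factor a f x) (factor a g x)) (sym (*-distribˡ-+ (x - a) _ _)))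
    where
    lemma : ∀ u v s t → u + v - (s + t) ≡ (u - s) + (v - t)
    lemma = solve-∀
  factor a (f ⊗ g) x = trans (lemma₁ (⟦ f ⟧ x) (⟦ g ⟧ x) (⟦ f ⟧ a) (⟦ g ⟧ a))
    (trans (cong₂ (λ y z → y * ⟦ g ⟧ x + ⟦ f ⟧ a * z) (factor a f x) (factor a g x))
           (lemma₂ (x - a) (⟦ quot a f ⟧ x) (⟦ g ⟧ x) (⟦ f ⟧ a) (⟦ quot a g ⟧ x)))
    where
    lemma₁ : ∀ u v s t → u * v - s * t ≡ (u - s) * v + s * (v - t)
    lemma₁ = solve-∀
    lemma₂ : ∀ d q g f r → d * q * g + f * (d * r) ≡ d * (q * g + f * r)
    lemma₂ = solve-∀

  -- Write f(X) - f(a) = (X - a) q(X). Since f(b) = f(a) and b ≠ a, the integer q(b) is 0, so q in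
  -- turn has the factor X - b.
  two-roots : ∀ a b f → .{{NonZero (b - a)}} → ⟦ f ⟧ b ≡ ⟦ f ⟧ a → ∀ x →
    (x - a) * (x - b) ∣ ⟦ f ⟧ x - ⟦ f ⟧ a
  two-roots a b f eq x = divides r (begin
    ⟦ f ⟧ x - ⟦ f ⟧ a                   ≡⟨ factor a f x ⟩
    (x - a) * ⟦ q ⟧ x                   ≡⟨ cong ((x - a) *_) (lemma₁ (⟦ q ⟧ x) (⟦ q ⟧ b)) ⟩
    (x - a) * (⟦ q ⟧ x - ⟦ q ⟧ b + ⟦ q ⟧ b)
      ≡⟨ cong₂ (λ y z → (x - a) * (y + z)) (factor b q x) q[b]≡0 ⟩
    (x - a) * ((x - b) * r + 0ℤ)        ≡⟨ lemma₂ (x - a) (x - b) r ⟩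
    r * ((x - a) * (x - b))             ∎)
    where
    open ≡-Reasoning
    q = quot a f
    r = ⟦ quot b q ⟧ x
    q[b]≡0 : ⟦ q ⟧ b ≡ 0ℤ
    q[b]≡0 = *-cancelˡ-≡ (b - a) _ _ (trans (sym (factor a f b))
      (trans (i≡j⇒i-j≡0 eq) (sym (*-zeroʳ (b - a)))))
    lemma₁ : ∀ u v → u ≡ u - v + v
    lemma₁ = solve-∀
    lemma₂ : ∀ u v r → u * (v * r + 0ℤ) ≡ r * (u * v)
    lemma₂ = solve-∀

  -- Comparison of (pK choose pe) with (K choose e)

  module Quotient (p₁ : ℕ) where

    p : ℕ
    p = suc p₁

    ε : ℤ
    ε = -1ℤ ^ p₁

    -- The factors belong to a < j ≤ a + s; for a = pi and s = p - 1 these j lie strictly between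
    -- two consecutive multiples of p.
    fallBlock : ℕ → ℕ → Poly
    fallBlock a zero    = con 1ℤ
    fallBlock a (suc s) = fallBlock a s ⊗ (var ⊕ con (- (+ suc (a ℕ.+ s))))

    riseBlock : ℕ → ℕ → ℤ
    riseBlock a zero    = 1ℤ
    riseBlock a (suc s) = riseBlock a s * + suc (a ℕ.+ s)

    -- fall e is the product of X − j over the j with 0 < j < pe and p ∤ j; rise e is the product of these j.
    fall : ℕ → Poly
    fall zero    = con 1ℤ
    fall (suc i) = fall i ⊗ fallBlock (p ℕ.* i) p₁

    rise : ℕ → ℤ
    rise zero    = 1ℤ
    rise (suc i) = rise i * riseBlock (p ℕ.* i) p₁

    -- This is `nCk-upper` iterated s + 1 times. The factors a + s + 1 and k - a stand apart from
    -- the blocks because they are the multiples of p when a = pi, s = p - 1 and k = pK.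
    block-ratio : ∀ k a s → + (k C suc (a ℕ.+ s)) * (+ suc (a ℕ.+ s) * riseBlock a s) ≡
      + (k C a) * ((+ k - + a) * ⟦ fallBlock a s ⟧ (+ k))
    block-ratio k a zero rewrite ℕₚ.+-identityʳ a = begin
      + (k C suc a) * (+ suc a * 1ℤ)   ≡⟨ lemma₁ (+ (k C suc a)) (+ suc a) ⟩
      + suc a * + (k C suc a)          ≡⟨ nCk-upper k a ⟩
      (+ k - + a) * + (k C a)          ≡⟨ lemma₂ (+ k - + a) (+ (k C a)) ⟩
      + (k C a) * ((+ k - + a) * 1ℤ)   ∎
      where
      open ≡-Reasoning
      lemma₁ : ∀ x y → x * (y * 1ℤ) ≡ y * x
      lemma₁ = solve-∀
      lemma₂ : ∀ x y → x * y ≡ y * (x * 1ℤ)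
      lemma₂ = solve-∀
    block-ratio k a (suc s) rewrite ℕₚ.+-suc a s = begin
      + (k C suc j) * (+ suc j * (riseBlock a s * + j))
        ≡⟨ lemma₁ (+ (k C suc j)) (+ suc j) (riseBlock a s) (+ j) ⟩
      + suc j * + (k C suc j) * (+ j * riseBlock a s)
        ≡⟨ cong (_* (+ j * riseBlock a s)) (nCk-upper k j) ⟩
      (+ k - + j) * + (k C j) * (+ j * riseBlock a s)
        ≡⟨ *-assoc (+ k - + j) (+ (k C j)) _ ⟩
      (+ k - + j) * (+ (k C j) * (+ j * riseBlock a s))
        ≡⟨ cong ((+ k - + j) *_) (block-ratio k a s) ⟩
      (+ k - + j) * (+ (k C a) * ((+ k - + a) * ⟦ fallBlock a s ⟧ (+ k)))
        ≡⟨ lemma₂ (+ k - + j) (+ (k C a)) (+ k - + a) (⟦ fallBlock a s ⟧ (+ k)) ⟩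
      + (k C a) * ((+ k - + a) * (⟦ fallBlock a s ⟧ (+ k) * (+ k - + j))) ∎
      where
      open ≡-Reasoning
      j = suc (a ℕ.+ s)
      lemma₁ : ∀ x y z w → x * (y * (z * w)) ≡ y * x * (w * z)
      lemma₁ = solve-∀
      lemma₂ : ∀ x y z w → x * (y * (z * w)) ≡ y * (z * (w * x))
      lemma₂ = solve-∀

    -- In the step from i to i + 1 the multiples of p contribute (pK - pi) / (p(i + 1)) = (K - i) /
    -- (i + 1), which is exactly the step of (K choose i); the other factors go into `fall` and
    -- `rise`.
    ratio : ∀ K e → + (p ℕ.* K C p ℕ.* e) * rise e ≡ + (K C e) * ⟦ fall e ⟧ (+ (p ℕ.* K))
    ratio K zero rewrite ℕₚ.*-zeroʳ p = refl
    ratio K (suc i) = *-cancelˡ-≡ (+ p * + suc i) _ _ (begin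
      + p * + suc i * (+ (p ℕ.* K C p ℕ.* suc i) * (rise i * rb))
        ≡⟨ lemma₁ (+ p * + suc i) (+ (p ℕ.* K C p ℕ.* suc i)) (rise i) rb ⟩
      + (p ℕ.* K C p ℕ.* suc i) * (+ p * + suc i * rb) * rise i
        ≡⟨ cong (λ z → + (p ℕ.* K C p ℕ.* suc i) * (z * rb) * rise i) (pos-* p (suc i)) ⟨
      + (p ℕ.* K C p ℕ.* suc i) * (+ (p ℕ.* suc i) * rb) * rise i
        ≡⟨ cong (λ z → + (p ℕ.* K C z) * (+ z * rb) * rise i) index ⟩
      + (p ℕ.* K C suc (p ℕ.* i ℕ.+ p₁)) * (+ suc (p ℕ.* i ℕ.+ p₁) * rb) * rise i
        ≡⟨ cong (_* rise i) (block-ratio (p ℕ.* K) (p ℕ.* i) p₁) ⟩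
      + (p ℕ.* K C p ℕ.* i) * ((+ (p ℕ.* K) - + (p ℕ.* i)) * fb) * rise i
        ≡⟨ lemma₂ (+ (p ℕ.* K C p ℕ.* i)) (+ (p ℕ.* K) - + (p ℕ.* i)) fb (rise i) ⟩
      + (p ℕ.* K C p ℕ.* i) * rise i * ((+ (p ℕ.* K) - + (p ℕ.* i)) * fb)
        ≡⟨ cong₂ (λ x y → x * (y * fb)) (ratio K i) (cong₂ _-_ (pos-* p K) (pos-* p i)) ⟩
      + (K C i) * F * ((+ p * + K - + p * + i) * fb)
        ≡⟨ lemma₃ (+ (K C i)) F (+ p) (+ K) (+ i) fb ⟩
      + p * ((+ K - + i) * + (K C i)) * (F * fb)
        ≡⟨ cong (λ z → + p * z * (F * fb)) (nCk-upper K i) ⟨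
      + p * (+ suc i * + (K C suc i)) * (F * fb)
        ≡⟨ lemma₄ (+ p) (+ suc i) (+ (K C suc i)) (F * fb) ⟩
      + p * + suc i * (+ (K C suc i) * (F * fb)) ∎)
      where
      open ≡-Reasoning
      rb = riseBlock (p ℕ.* i) p₁
      fb = ⟦ fallBlock (p ℕ.* i) p₁ ⟧ (+ (p ℕ.* K))
      F  = ⟦ fall i ⟧ (+ (p ℕ.* K))
      index : p ℕ.* suc i ≡ suc (p ℕ.* i ℕ.+ p₁)
      index = trans (ℕₚ.*-suc p i) (cong suc (ℕₚ.+-comm p₁ (p ℕ.* i)))
      lemma₁ : ∀ x y z w → x * (y * (z * w)) ≡ y * (x * w) * z
      lemma₁ = solve-∀
      lemma₂ : ∀ x y z w → x * (y * z) * w ≡ x * w * (y * z)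
      lemma₂ = solve-∀
      lemma₃ : ∀ b f p k i g → b * f * ((p * k - p * i) * g) ≡ p * ((k - i) * b) * (f * g)
      lemma₃ = solve-∀
      lemma₄ : ∀ x y z w → x * (y * z) * w ≡ x * y * (z * w)
      lemma₄ = solve-∀

    -- The case K = e of `ratio`, where both binomials are 1; it takes the place of the substitution
    -- j ↦ pe - j in the product.
    fall-pe : ∀ e → ⟦ fall e ⟧ (+ (p ℕ.* e)) ≡ rise e
    fall-pe e = begin
      ⟦ fall e ⟧ (+ (p ℕ.* e))               ≡⟨ *-identityˡ _ ⟨
      1ℤ * ⟦ fall e ⟧ (+ (p ℕ.* e))          ≡⟨ cong (λ z → + z * ⟦ fall e ⟧ (+ (p ℕ.* e))) (nCn≡1 e) ⟨
      + (e C e) * ⟦ fall e ⟧ (+ (p ℕ.* e))   ≡⟨ ratio e e ⟨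
      + (p ℕ.* e C p ℕ.* e) * rise e         ≡⟨ cong (λ z → + z * rise e) (nCn≡1 (p ℕ.* e)) ⟩
      1ℤ * rise e                            ≡⟨ *-identityˡ _ ⟩
      rise e                                 ∎
      where open ≡-Reasoning

    fallBlock-0 : ∀ a s → ⟦ fallBlock a s ⟧ 0ℤ ≡ -1ℤ ^ s * riseBlock a s
    fallBlock-0 a zero = refl
    fallBlock-0 a (suc s) = trans (cong (_* (0ℤ + - (+ suc (a ℕ.+ s)))) (fallBlock-0 a s))
      (lemma (-1ℤ ^ s) (riseBlock a s) (+ suc (a ℕ.+ s)))
      where
      lemma : ∀ x y z → x * y * (0ℤ + - z) ≡ -1ℤ * x * (y * z)
      lemma = solve-∀

    -- Each of the e blocks has p - 1 factors -j, so it contributes one sign ε.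
    fall-0 : ∀ e → ⟦ fall e ⟧ 0ℤ ≡ ε ^ e * rise e
    fall-0 zero = refl
    fall-0 (suc i) = trans (cong₂ _*_ (fall-0 i) (fallBlock-0 (p ℕ.* i) p₁))
      (lemma (ε ^ i) (rise i) ε (riseBlock (p ℕ.* i) p₁))
      where
      lemma : ∀ x y z w → x * y * (z * w) ≡ z * x * (y * w)
      lemma = solve-∀

    module _ (p-prime : Prime p) where

      -- This amounts to p ∤ y, in the form in which it is used: y may be cancelled from
      -- divisibility by any power of p.
      Unit : ℤ → Set
      Unit y = ∀ t x → + (p ℕ.^ t) ∣ y * x → + (p ℕ.^ t) ∣ x

      unit-* : ∀ y z → Unit y → Unit z → Unit (y * z)
      unit-* y z uy uz t x h = uz t x (uy t (z * x) (subst (+ (p ℕ.^ t) ∣_) (*-assoc y z x) h))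

      -- Euclid's lemma removes one factor p from x at a time.
      nonmultiple-unit : ∀ j → ¬ (p ℕᵈ.∣ j) → Unit (+ j)
      nonmultiple-unit j p∤j t x h = ∣ᵤ⇒∣ (cancel t ∣ x ∣
        (subst (p ℕ.^ t ℕᵈ.∣_) (abs-* (+ j) x) (∣⇒∣ᵤ h)))
        where
        cancel : ∀ t x → p ℕ.^ t ℕᵈ.∣ j ℕ.* x → p ℕ.^ t ℕᵈ.∣ x
        cancel zero x _ = ℕᵈ.1∣ x
        cancel (suc t) x h with euclidsLemma j x p-prime (ℕᵈ.∣-trans (ℕᵈ.m∣m*n (p ℕ.^ t)) h)
        ... | inj₁ p∣j = contradiction p∣j p∤j
        ... | inj₂ (ℕᵈ.divides y refl) = subst (p ℕ.* p ℕ.^ t ℕᵈ.∣_) (ℕₚ.*-comm p y)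
          (ℕᵈ.*-monoʳ-∣ p (cancel t y (ℕᵈ.*-cancelˡ-∣ p (subst (p ℕ.* p ℕ.^ t ℕᵈ.∣_) shuffle h))))
          where
          shuffle : j ℕ.* (y ℕ.* p) ≡ p ℕ.* (j ℕ.* y)
          shuffle = trans (sym (ℕₚ.*-assoc j y p)) (ℕₚ.*-comm (j ℕ.* y) p)

      pi+r-nonmultiple : ∀ i s → s ℕ.< p₁ → ¬ (p ℕᵈ.∣ suc (p ℕ.* i ℕ.+ s))
      pi+r-nonmultiple i s s<p₁ h = ℕₚ.<⇒≱ (ℕ.s≤s s<p₁) (ℕᵈ.∣⇒≤
        (ℕᵈ.∣m+n∣m⇒∣n (subst (p ℕᵈ.∣_) (sym (ℕₚ.+-suc (p ℕ.* i) s)) h) (ℕᵈ.m∣m*n i)))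

      unit-riseBlock : ∀ i s → s ℕ.≤ p₁ → Unit (riseBlock (p ℕ.* i) s)
      unit-riseBlock i zero _ t x h = subst (+ (p ℕ.^ t) ∣_) (*-identityˡ x) h
      unit-riseBlock i (suc s) s<p₁ = unit-* (riseBlock (p ℕ.* i) s) _ (unit-riseBlock i s (ℕₚ.<⇒≤ s<p₁))
        (nonmultiple-unit _ (pi+r-nonmultiple i s s<p₁))

      unit-rise : ∀ e → Unit (rise e)
      unit-rise zero t x h = subst (+ (p ℕ.^ t) ∣_) (*-identityˡ x) h
      unit-rise (suc e) = unit-* (rise e) _ (unit-rise e) (unit-riseBlock e p₁ ℕₚ.≤-refl)

      module _ (β K : ℕ) (p^β∣K : p ℕ.^ β ℕᵈ.∣ K) where

        private
          k  = p ℕ.* K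
          α  = suc β
          K∣ : + (p ℕ.^ β) ∣ + K
          K∣ = ∣ᵤ⇒∣ p^β∣K
          k∣ : + (p ℕ.^ α) ∣ + k
          k∣ = ∣ᵤ⇒∣ (ℕᵈ.*-monoʳ-∣ p p^β∣K)

          ^-pres-∣ : ∀ s t {x y} → + (p ℕ.^ s) ∣ x → + (p ℕ.^ t) ∣ y → + (p ℕ.^ (s ℕ.+ t)) ∣ x * y
          ^-pres-∣ s t {x} {y} h g = subst (_∣ x * y) (sym (pos-^-+ p s t)) (*-pres-∣ h g)

        -- In e (k choose e) = k (k - 1 choose e - 1) the power p^α divides k, and e can be
        -- cancelled.
        nonmultiple-binomial : ∀ e → ¬ (p ℕᵈ.∣ e) → + (p ℕ.^ α) ∣ + (k C e)
        nonmultiple-binomial zero p∤e = contradiction (p ℕᵈ.∣0) p∤e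
        nonmultiple-binomial (suc e) p∤e = nonmultiple-unit (suc e) p∤e α _
          (subst (+ (p ℕ.^ α) ∣_) (sym (nCk-absorb k e)) (∣m⇒∣m*n _ k∣))

        -- Up to the cancellable factor `rise e`, a comparison of binomials becomes a comparison of
        -- values of the polynomial `fall e`.
        rise-difference : ∀ e s → rise e * (+ (k C p ℕ.* e) - s * + (K C e)) ≡
          + (K C e) * (⟦ fall e ⟧ (+ k) - s * rise e)
        rise-difference e s = trans (lemma₁ (rise e) (+ (k C p ℕ.* e)) s (+ (K C e)))
          (trans (cong (_- s * (rise e * + (K C e))) (ratio K e))
                 (lemma₂ (+ (K C e)) (⟦ fall e ⟧ (+ k)) s (rise e)))
          where
          lemma₁ : ∀ r b s c → r * (b - s * c) ≡ b * r - s * (r * c)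
          lemma₁ = solve-∀
          lemma₂ : ∀ c f s r → c * f - s * (r * c) ≡ c * (f - s * r)
          lemma₂ = solve-∀

        -- If ε^e = 1, then fall e takes the value rise e at both 0 and pe, so k (k − pe) divides its value at k
        -- minus rise e; since (K − e) (K choose e) = K (K − 1 choose e), multiplying by K choose e gives k².
        multiple-binomial-even : ∀ e → ε ^ e ≡ 1ℤ →
          + (p ℕ.^ (α ℕ.+ α)) ∣ + (k C p ℕ.* e) - ε ^ e * + (K C e)
        -- At e = 0 the points 0 and pe coincide, so `two-roots` does not apply; here both binomials
        -- are 1.
        multiple-binomial-even zero _ rewrite ℕₚ.*-zeroʳ p = divides 0ℤ refl
        multiple-binomial-even e@(suc e₁) ε^e≡1 = unit-rise e (α ℕ.+ α) _
          (subst (+ (p ℕ.^ (α ℕ.+ α)) ∣_) (sym (rise-difference e (ε ^ e)))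
            (∣-trans (^-pres-∣ α α k∣ k∣) k²∣))
          where
          f0≡rise = trans (fall-0 e) (trans (cong (_* rise e) ε^e≡1) (*-identityˡ (rise e)))

          roots : (+ k - 0ℤ) * (+ k - + (p ℕ.* e)) ∣ ⟦ fall e ⟧ (+ k) - ⟦ fall e ⟧ 0ℤ
          roots = two-roots 0ℤ (+ (p ℕ.* e)) (fall e) (trans (fall-pe e) (sym f0≡rise)) (+ k)

          lemma : ∀ c p K e → c * ((p * K - 0ℤ) * (p * K - p * e)) ≡ p * K * p * ((K - e) * c)
          lemma = solve-∀

          k²∣ : + k * + k ∣ + (K C e) * (⟦ fall e ⟧ (+ k) - ε ^ e * rise e)
          k²∣ = subst (λ z → + k * + k ∣ + (K C e) * (⟦ fall e ⟧ (+ k) - z)) (fall-0 e)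
            (∣-trans (divides (+ (ℕ.pred K C e)) (begin
              + (K C e) * ((+ k - 0ℤ) * (+ k - + (p ℕ.* e)))
                ≡⟨ cong₂ (λ x y → + (K C e) * ((x - 0ℤ) * (x - y))) (pos-* p K) (pos-* p e) ⟩
              + (K C e) * ((+ p * + K - 0ℤ) * (+ p * + K - + p * + e))
                ≡⟨ lemma (+ (K C e)) (+ p) (+ K) (+ e) ⟩
              + p * + K * + p * ((+ K - + e) * + (K C e))
                ≡⟨ cong (+ p * + K * + p *_) (nCk-lower K e) ⟩
              + p * + K * + p * (+ K * + (ℕ.pred K C e))
                ≡⟨ lemma₂ (+ p) (+ K) (+ (ℕ.pred K C e)) ⟩
              + (ℕ.pred K C e) * (+ p * + K * (+ p * + K))
                ≡⟨ cong (λ x → + (ℕ.pred K C e) * (x * x)) (pos-* p K) ⟨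
              + (ℕ.pred K C e) * (+ k * + k) ∎))
              (*-monoʳ-∣ (+ (K C e)) roots))
            where
            open ≡-Reasoning
            lemma₂ : ∀ p K c → p * K * p * (K * c) ≡ c * (p * K * (p * K))
            lemma₂ = solve-∀

        -- The difference of the values of `fall e` at k and at 0 gives a factor k, and e (K choose
        -- e) = K (K - 1 choose e - 1) gives a factor K once e is cancelled. For p = 2 and odd e,
        -- where ε^e = -1, the modulus is 2^(2α - 1).
        multiple-binomial-weak : ∀ e → ¬ (p ℕᵈ.∣ e) →
          + (p ℕ.^ (β ℕ.+ α)) ∣ + (k C p ℕ.* e) - ε ^ e * + (K C e)
        multiple-binomial-weak zero p∤e = contradiction (p ℕᵈ.∣0) p∤e
        multiple-binomial-weak e@(suc e₁) p∤e = unit-* (+ e) (rise e) (nonmultiple-unit e p∤e) (unit-rise e) (β ℕ.+ α) _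
          (∣-trans (^-pres-∣ β α K∣ k∣) (divides (+ (ℕ.pred K C e₁) * q) (begin
            + e * rise e * (+ (k C p ℕ.* e) - ε ^ e * + (K C e))
              ≡⟨ *-assoc (+ e) (rise e) _ ⟩
            + e * (rise e * (+ (k C p ℕ.* e) - ε ^ e * + (K C e)))
              ≡⟨ cong (+ e *_) (rise-difference e (ε ^ e)) ⟩
            + e * (+ (K C e) * (⟦ fall e ⟧ (+ k) - ε ^ e * rise e))
              ≡⟨ cong (λ z → + e * (+ (K C e) * (⟦ fall e ⟧ (+ k) - z))) (fall-0 e) ⟨
            + e * (+ (K C e) * (⟦ fall e ⟧ (+ k) - ⟦ fall e ⟧ 0ℤ))
              ≡⟨ cong (λ z → + e * (+ (K C e) * z)) (factor 0ℤ (fall e) (+ k)) ⟩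
            + e * (+ (K C e) * ((+ k - 0ℤ) * q))
              ≡⟨ *-assoc (+ e) (+ (K C e)) _ ⟨
            + e * + (K C e) * ((+ k - 0ℤ) * q)
              ≡⟨ cong (_* ((+ k - 0ℤ) * q)) (nCk-absorb K e₁) ⟩
            + K * + (ℕ.pred K C e₁) * ((+ k - 0ℤ) * q)
              ≡⟨ lemma (+ K) (+ (ℕ.pred K C e₁)) (+ k) q ⟩
            + (ℕ.pred K C e₁) * q * (+ K * + k) ∎)))
          where
          open ≡-Reasoning
          q = ⟦ quot 0ℤ (fall e) ⟧ (+ k)
          lemma : ∀ K c k q → K * c * ((k - 0ℤ) * q) ≡ c * q * (K * k)
          lemma = solve-∀

-- Finite sums, quadratic forms and weighted sums over rows

module RowSums where

  open import Data.Nat.Base as ℕ using (ℕ; zero; suc)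
  import Data.Nat.Properties as ℕₚ
  import Data.Nat.Divisibility as ℕᵈ
  open import Data.Nat.Combinatorics using (_C_)
  open import Data.Integer.Base hiding (suc; pred)
  open import Data.Integer.Properties hiding (suc-+; pred-suc)
  open import Data.Integer.Divisibility.Signed
  open import Data.Integer.Tactic.RingSolver using (solve-∀)
  open import Function.Base using (_∘_)
  open import Relation.Nullary using (¬_; yes; no)
  open import Relation.Binary.PropositionalEquality
  open Binomials using (pascal; *-pres-∣)

  infixr 6.5 Σ<
  Σ< : ℕ → (ℕ → ℤ) → ℤ
  Σ< zero    f = 0ℤ
  Σ< (suc n) f = f 0 + Σ< n (f ∘ suc)

  syntax Σ< n (λ i → t) = Σ[ i < n ] t

  Σ<-cong : ∀ n {f g} → (∀ i → f i ≡ g i) → Σ< n f ≡ Σ< n g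
  Σ<-cong zero    h = refl
  Σ<-cong (suc n) h = cong₂ _+_ (h 0) (Σ<-cong n (h ∘ suc))

  Σ<-zero : ∀ n → Σ[ i < n ] 0ℤ ≡ 0ℤ
  Σ<-zero zero    = refl
  Σ<-zero (suc n) = trans (+-identityˡ _) (Σ<-zero n)

  Σ<-+ : ∀ n f g → Σ[ i < n ] (f i + g i) ≡ Σ< n f + Σ< n g
  Σ<-+ zero    f g = refl
  Σ<-+ (suc n) f g = trans (cong (λ z → f 0 + g 0 + z) (Σ<-+ n (f ∘ suc) (g ∘ suc)))
    (lemma (f 0) (g 0) (Σ< n (f ∘ suc)) (Σ< n (g ∘ suc)))
    where
    lemma : ∀ x y z w → x + y + (z + w) ≡ x + z + (y + w)
    lemma = solve-∀

  Σ<-* : ∀ n c f → Σ[ i < n ] (c * f i) ≡ c * Σ< n f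
  Σ<-* zero    c f = sym (*-zeroʳ c)
  Σ<-* (suc n) c f = trans (cong (λ z → c * f 0 + z) (Σ<-* n c (f ∘ suc))) (sym (*-distribˡ-+ c (f 0) _))

  Σ<-swap : ∀ m n (f : ℕ → ℕ → ℤ) → Σ[ i < m ] Σ[ j < n ] f i j ≡ Σ[ j < n ] Σ[ i < m ] f i j
  Σ<-swap zero    n f = sym (Σ<-zero n)
  Σ<-swap (suc m) n f = trans (cong (λ z → Σ< n (f 0) + z) (Σ<-swap m n (f ∘ suc)))
    (sym (Σ<-+ n (f 0) (λ j → Σ[ i < m ] f (suc i) j)))

  Σ<-++ : ∀ m n f → Σ< (m ℕ.+ n) f ≡ Σ< m f + Σ[ i < n ] f (m ℕ.+ i)
  Σ<-++ zero    n f = sym (+-identityˡ _)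
  Σ<-++ (suc m) n f = trans (cong (λ z → f 0 + z) (Σ<-++ m n (f ∘ suc))) (sym (+-assoc (f 0) _ _))

  ∣0 : ∀ {T} → T ∣ 0ℤ
  ∣0 = divides 0ℤ refl

  ≡⇒∣- : ∀ {T x y} → x ≡ y → T ∣ x - y
  ≡⇒∣- {T} eq = subst (T ∣_) (sym (i≡j⇒i-j≡0 eq)) ∣0

  ∣-transitive : ∀ {T} x y z → T ∣ x - y → T ∣ y - z → T ∣ x - z
  ∣-transitive {T} x y z h g = subst (T ∣_) (lemma x y z) (∣m∣n⇒∣m+n h g)
    where
    lemma : ∀ x y z → (x - y) + (y - z) ≡ x - z
    lemma = solve-∀

  Σ<-∣ : ∀ {T} n {f} → (∀ i → i ℕ.< n → T ∣ f i) → T ∣ Σ< n f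
  Σ<-∣ zero    h = ∣0
  Σ<-∣ (suc n) h = ∣m∣n⇒∣m+n (h 0 ℕ.z<s) (Σ<-∣ n (λ i i<n → h (suc i) (ℕ.s<s i<n)))

  -- The range is cut into K blocks of length p, each of which starts with its only multiple of p.
  Σ<-multiples : ∀ {T} p₁ (let p = suc p₁) K f g →
    (∀ i → ¬ (p ℕᵈ.∣ i) → T ∣ f i) → (∀ e → T ∣ f (p ℕ.* e) - g e) →
    T ∣ Σ< (K ℕ.* p) f - Σ< K g
  Σ<-multiples p₁ zero f g _ _ = ∣0
  Σ<-multiples {T} p₁ (suc K) f g off on = subst (T ∣_) (sym regroup)
    (∣m∣n⇒∣m+n (∣m∣n⇒∣m+n on₀ (Σ<-∣ p₁ λ i i<p₁ → off (suc i)
        (λ h → ℕₚ.<⇒≱ (ℕ.s<s i<p₁) (ℕᵈ.∣⇒≤ h))))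
      (Σ<-multiples p₁ K (f ∘ (p ℕ.+_)) (g ∘ suc)
        (λ i p∤i → off (p ℕ.+ i) (λ h → p∤i (ℕᵈ.∣m+n∣m⇒∣n h ℕᵈ.∣-refl)))
        (λ e → subst (λ j → T ∣ f j - g (suc e)) (ℕₚ.*-suc p e) (on (suc e)))))
    where
    p = suc p₁
    on₀ : T ∣ f 0 - g 0
    on₀ = subst (λ j → T ∣ f j - g 0) (ℕₚ.*-zeroʳ p) (on 0)
    lemma : ∀ a b c d e → a + b + c - (d + e) ≡ a - d + b + (c - e)
    lemma = solve-∀
    regroup : Σ< (p ℕ.+ K ℕ.* p) f - Σ< (suc K) g ≡
      f 0 - g 0 + Σ< p₁ (f ∘ suc) + (Σ< (K ℕ.* p) (f ∘ (p ℕ.+_)) - Σ< K (g ∘ suc))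
    regroup = trans (cong (_- Σ< (suc K) g) (Σ<-++ p (K ℕ.* p) f))
      (lemma (f 0) (Σ< p₁ (f ∘ suc)) (Σ< (K ℕ.* p) (f ∘ (p ℕ.+_))) (g 0) (Σ< K (g ∘ suc)))

  Σ<Σ<-cong : ∀ n {f g : ℕ → ℕ → ℤ} → (∀ i j → f i j ≡ g i j) →
    Σ[ i < n ] Σ[ j < n ] f i j ≡ Σ[ i < n ] Σ[ j < n ] g i j
  Σ<Σ<-cong n h = Σ<-cong n λ i → Σ<-cong n (h i)

  Σ<Σ<-+ : ∀ n (f g : ℕ → ℕ → ℤ) → Σ[ i < n ] Σ[ j < n ] (f i j + g i j) ≡
    Σ[ i < n ] Σ[ j < n ] f i j + Σ[ i < n ] Σ[ j < n ] g i j
  Σ<Σ<-+ n f g = trans (Σ<-cong n λ i → Σ<-+ n (f i) (g i))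
    (Σ<-+ n (λ i → Σ< n (f i)) (λ i → Σ< n (g i)))

  Σ<Σ<-* : ∀ n c (f : ℕ → ℕ → ℤ) → Σ[ i < n ] Σ[ j < n ] (c * f i j) ≡ c * (Σ[ i < n ] Σ[ j < n ] f i j)
  Σ<Σ<-* n c f = trans (Σ<-cong n λ i → Σ<-* n c (f i)) (Σ<-* n c (λ i → Σ< n (f i)))

  -- The quadratic form that joins the two rows of a symbol: a i will count the rows with value sum
  -- i, and w i j will test the total weight.
  pairSum : ℕ → (ℕ → ℕ → ℤ) → (ℕ → ℤ) → ℤ
  pairSum n w a = Σ[ i < n ] Σ[ j < n ] (w i j * (a i * a j))

  -- The two terms linear in (a − b)/M agree by the symmetry of w, which is how a factor 2 is gained.
  symmetric-form : ∀ {T M} → T ∣ M + M → T ∣ M * M → ∀ n (w : ℕ → ℕ → ℤ) → (∀ i j → w i j ≡ w j i) →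
    ∀ (a b : ℕ → ℤ) → (∀ i → M ∣ a i - b i) →
    T ∣ pairSum n w a - pairSum n w b
  symmetric-form {T} {M} T∣2M T∣M² n w w-sym a b M∣a-b =
    subst (T ∣_) (sym expansion) (∣m∣n⇒∣m+n (∣m⇒∣m*n X T∣2M) (∣m⇒∣m*n Y T∣M²))
    where
    open ≡-Reasoning
    u : ℕ → ℤ
    u i = _∣_.quotient (M∣a-b i)

    S X X′ Y : ℤ
    S  = pairSum n w b
    X  = Σ[ i < n ] Σ[ j < n ] (w i j * (u i * b j))
    X′ = Σ[ i < n ] Σ[ j < n ] (w i j * (u j * b i))
    Y  = Σ[ i < n ] Σ[ j < n ] (w i j * (u i * u j))

    a≡ : ∀ i → a i ≡ b i + u i * M
    a≡ i = trans (lemma (a i) (b i)) (cong (λ z → b i + z) (_∣_.equality (M∣a-b i)))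
      where
      lemma : ∀ x y → x ≡ y + (x - y)
      lemma = solve-∀

    X′≡X : X′ ≡ X
    X′≡X = trans (Σ<-swap n n (λ i j → w i j * (u j * b i)))
      (Σ<Σ<-cong n λ i j → cong (_* (u i * b j)) (w-sym j i))

    term : ∀ i j → w i j * (a i * a j) ≡
      w i j * (b i * b j) + (M * (w i j * (u i * b j)) + (M * (w i j * (u j * b i)) + M * M * (w i j * (u i * u j))))
    term i j = trans (cong₂ (λ x y → w i j * (x * y)) (a≡ i) (a≡ j)) (lemma (w i j) (b i) (b j) (u i) (u j) M)
      where
      lemma : ∀ w b c u v M → w * ((b + u * M) * (c + v * M)) ≡
        w * (b * c) + (M * (w * (u * c)) + (M * (w * (v * b)) + M * M * (w * (u * v))))
      lemma = solve-∀

    expansion : pairSum n w a - S ≡ (M + M) * X + M * M * Y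
    expansion = begin
      pairSum n w a - S
        ≡⟨ cong (_- S) (trans (Σ<Σ<-cong n term) (Σ<Σ<-+ n _ _)) ⟩
      S + (Σ[ i < n ] Σ[ j < n ] (M * (w i j * (u i * b j)) + (M * (w i j * (u j * b i)) + M * M * (w i j * (u i * u j))))) - S
        ≡⟨ cong (λ z → S + z - S) (trans (Σ<Σ<-+ n _ _) (cong₂ _+_ (Σ<Σ<-* n M _)
             (trans (Σ<Σ<-+ n _ _) (cong₂ _+_ (Σ<Σ<-* n M _) (Σ<Σ<-* n (M * M) _))))) ⟩
      S + (M * X + (M * X′ + M * M * Y)) - S
        ≡⟨ cong (λ z → S + (M * X + (M * z + M * M * Y)) - S) X′≡X ⟩
      S + (M * X + (M * X + M * M * Y)) - S
        ≡⟨ lemma S M X Y ⟩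
      (M + M) * X + M * M * Y ∎
      where
      lemma : ∀ S M X Y → S + (M * X + (M * X + M * M * Y)) - S ≡ (M + M) * X + M * M * Y
      lemma = solve-∀

  -- rowSum k g c m a b is the sum of g (a + number of entries) (b + sum of the values) over the strictly
  -- decreasing rows whose entries precede the entry of value m and (0-based) colour c.
  rowSum : ℕ → (ℕ → ℕ → ℤ) → ℕ → ℕ → ℕ → ℕ → ℤ
  rowSum k g zero    zero    a b = g a b
  rowSum k g zero    (suc m) a b = rowSum k g k m a b
  rowSum k g (suc c) m       a b = rowSum k g c m a b + rowSum k g c m (suc a) (b ℕ.+ m)

  -- Pascal's rule turns the recursion over the colours of value m into a sum over the number e of
  -- entries of that value. Since (c choose e) = 0 for e > c, any bound B > c serves; later B is
  -- chosen as a multiple of p.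
  rowSum-colors : ∀ k g m c a b B → c ℕ.< B →
    rowSum k g c m a b ≡ Σ[ e < B ] (+ (c C e) * rowSum k g 0 m (a ℕ.+ e) (b ℕ.+ m ℕ.* e))
  rowSum-colors k g m zero a b (suc B) _ = sym (begin
    1ℤ * rowSum k g 0 m (a ℕ.+ 0) (b ℕ.+ m ℕ.* 0) + Σ[ e < B ] (+ (0 C suc e) * h (suc e))
      ≡⟨ cong₂ _+_ (*-identityˡ (h 0)) (trans (Σ<-cong B (λ e → *-zeroˡ (h (suc e)))) (Σ<-zero B)) ⟩
    rowSum k g 0 m (a ℕ.+ 0) (b ℕ.+ m ℕ.* 0) + 0ℤ
      ≡⟨ +-identityʳ _ ⟩
    rowSum k g 0 m (a ℕ.+ 0) (b ℕ.+ m ℕ.* 0)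
      ≡⟨ cong₂ (rowSum k g 0 m) (ℕₚ.+-identityʳ a)
           (trans (cong (b ℕ.+_) (ℕₚ.*-zeroʳ m)) (ℕₚ.+-identityʳ b)) ⟩
    rowSum k g 0 m a b ∎)
    where
    open ≡-Reasoning
    h : ℕ → ℤ
    h e = rowSum k g 0 m (a ℕ.+ e) (b ℕ.+ m ℕ.* e)
  rowSum-colors k g m (suc c) a b (suc B) (ℕ.s<s c<B) = begin
    rowSum k g c m a b + rowSum k g c m (suc a) (b ℕ.+ m)
      -- Rows with the last colour are summed over e < B only: that colour raises the number of
      -- entries of value m to e + 1, which then stays below B + 1.
      ≡⟨ cong₂ _+_ (rowSum-colors k g m c a b (suc B) (ℕₚ.m<n⇒m<1+n c<B))
                   (rowSum-colors k g m c (suc a) (b ℕ.+ m) B c<B) ⟩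
    1ℤ * h 0 + Σ[ e < B ] (+ (c C suc e) * h (suc e)) +
      Σ[ e < B ] (+ (c C e) * rowSum k g 0 m (suc a ℕ.+ e) (b ℕ.+ m ℕ.+ m ℕ.* e))
      ≡⟨ cong (λ z → 1ℤ * h 0 + Σ[ e < B ] (+ (c C suc e) * h (suc e)) + z)
           (Σ<-cong B λ e → cong (+ (c C e) *_) (cong₂ (rowSum k g 0 m) (sym (ℕₚ.+-suc a e)) (shift e))) ⟩
    1ℤ * h 0 + Σ[ e < B ] (+ (c C suc e) * h (suc e)) + Σ[ e < B ] (+ (c C e) * h (suc e))
      ≡⟨ lemma (1ℤ * h 0) _ _ ⟩
    1ℤ * h 0 + (Σ[ e < B ] (+ (c C e) * h (suc e)) + Σ[ e < B ] (+ (c C suc e) * h (suc e)))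
      ≡⟨ cong (λ z → 1ℤ * h 0 + z) (Σ<-+ B (λ e → + (c C e) * h (suc e)) (λ e → + (c C suc e) * h (suc e))) ⟨
    1ℤ * h 0 + Σ[ e < B ] (+ (c C e) * h (suc e) + + (c C suc e) * h (suc e))
      ≡⟨ cong (λ z → 1ℤ * h 0 + z) (Σ<-cong B λ e → trans
           (sym (*-distribʳ-+ (h (suc e)) (+ (c C e)) (+ (c C suc e))))
           (cong (_* h (suc e)) (sym (pascal c e)))) ⟩
    1ℤ * h 0 + Σ[ e < B ] (+ (suc c C suc e) * h (suc e)) ∎
    where
    open ≡-Reasoning
    h : ℕ → ℤ
    h e = rowSum k g 0 m (a ℕ.+ e) (b ℕ.+ m ℕ.* e)
    shift : ∀ e → b ℕ.+ m ℕ.+ m ℕ.* e ≡ b ℕ.+ m ℕ.* suc e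
    shift e = trans (ℕₚ.+-assoc b m (m ℕ.* e)) (cong (b ℕ.+_) (sym (ℕₚ.*-suc m e)))
    lemma : ∀ x y z → x + y + z ≡ x + (z + y)
    lemma = solve-∀

  rowSum-scale : ∀ k s {g h} → (∀ a b → g a b ≡ s * h a b) →
    ∀ c m a b → rowSum k g c m a b ≡ s * rowSum k h c m a b
  rowSum-scale k s eq zero    zero    a b = eq a b
  rowSum-scale k s eq zero    (suc m) a b = rowSum-scale k s eq k m a b
  rowSum-scale k s eq (suc c) m       a b =
    trans (cong₂ _+_ (rowSum-scale k s eq c m a b) (rowSum-scale k s eq c m (suc a) (b ℕ.+ m)))
          (sym (*-distribˡ-+ s _ _))

  -- Passage from pK colours to K colours in row sums

  module Transfer
    (p₁ K : ℕ) (ε A M : ℤ) (ε²≡1 : ε * ε ≡ 1ℤ) (M∣A² : M ∣ A * A)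
    (A∣binomial : ∀ e → ¬ (suc p₁ ℕᵈ.∣ e) → A ∣ + (suc p₁ ℕ.* K C e))
    (M∣binomial : ∀ e → M ∣ + (suc p₁ ℕ.* K C suc p₁ ℕ.* e) - ε ^ e * + (K C e))
    where

    private
      p = suc p₁
      k = p ℕ.* K

    ε^e²≡1 : ∀ e → ε ^ e * ε ^ e ≡ 1ℤ
    ε^e²≡1 zero    = refl
    ε^e²≡1 (suc e) = trans (lemma ε (ε ^ e)) (cong₂ _*_ ε²≡1 (ε^e²≡1 e))
      where
      lemma : ∀ x y → x * y * (x * y) ≡ x * x * (y * y)
      lemma = solve-∀

    -- Either some multiplicity e is not divisible by p, and its binomial supplies A, or all are,
    -- and then Q persists to the end of the row, where g supplies A.
    rowSum-∣ : ∀ (Q : ℕ → Set) g → (∀ a e → Q a → p ℕᵈ.∣ e → Q (a ℕ.+ e)) →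
      (∀ a b → Q a → A ∣ g a b) → ∀ m a b → Q a → A ∣ rowSum k g 0 m a b
    rowSum-∣ Q g Q-step A∣g zero    a b Qa = A∣g a b Qa
    rowSum-∣ Q g Q-step A∣g (suc m) a b Qa =
      subst (A ∣_) (sym (rowSum-colors k g m k a b (suc k) (ℕₚ.n<1+n k))) (Σ<-∣ (suc k) (λ e _ → term e))
      where
      term : ∀ e → A ∣ + (k C e) * rowSum k g 0 m (a ℕ.+ e) (b ℕ.+ m ℕ.* e)
      term e with p ℕᵈ.∣? e
      ... | yes p∣e = ∣n⇒∣m*n (+ (k C e)) (rowSum-∣ Q g Q-step A∣g m _ _ (Q-step a e Qa p∣e))
      ... | no  p∤e = ∣m⇒∣m*n _ (A∣binomial e p∤e)

    -- Replacing (pK choose pe) by ε^e (K choose e) at each value produces the sign ε^(a′ - a),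
    -- where a and a′ are the initial and final counts divided by p. As ε² = 1, it equals ε^a
    -- ε^(a′), and the second factor is absorbed into the function that is summed.
    rowSum-transfer : ∀ g → (∀ a b → ¬ (p ℕᵈ.∣ a) → A ∣ g a b) → ∀ m a b →
      M ∣ rowSum k g 0 m (p ℕ.* a) (p ℕ.* b) -
          ε ^ a * rowSum K (λ a b → ε ^ a * g (p ℕ.* a) (p ℕ.* b)) 0 m a b
    rowSum-transfer g A∣g zero a b = ≡⇒∣- (begin
      g (p ℕ.* a) (p ℕ.* b)                      ≡⟨ *-identityˡ _ ⟨
      1ℤ * g (p ℕ.* a) (p ℕ.* b)                 ≡⟨ cong (_* g (p ℕ.* a) (p ℕ.* b)) (ε^e²≡1 a) ⟨
      ε ^ a * ε ^ a * g (p ℕ.* a) (p ℕ.* b)      ≡⟨ *-assoc (ε ^ a) (ε ^ a) _ ⟩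
      ε ^ a * (ε ^ a * g (p ℕ.* a) (p ℕ.* b))    ∎)
      where open ≡-Reasoning
    rowSum-transfer g A∣g (suc m) a b = subst₂ (λ x y → M ∣ x - ε ^ a * y)
      -- The bound (K + 1)p lies above k = pK and is a multiple of p, as the cutting into blocks of
      -- length p requires.
      (sym (rowSum-colors k g m k (p ℕ.* a) (p ℕ.* b) (suc K ℕ.* p) k<B))
      (sym (rowSum-colors K g′ m K a b (suc K) (ℕₚ.n<1+n K)))
      (subst (λ z → M ∣ Σ< (suc K ℕ.* p) f - z) (Σ<-* (suc K) (ε ^ a) f′)
        (Σ<-multiples p₁ (suc K) f (λ e → ε ^ a * f′ e) off on))
      where
      g′ : ℕ → ℕ → ℤ
      g′ a b = ε ^ a * g (p ℕ.* a) (p ℕ.* b)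

      f f′ : ℕ → ℤ
      f  e = + (k C e) * rowSum k g 0 m (p ℕ.* a ℕ.+ e) (p ℕ.* b ℕ.+ m ℕ.* e)
      f′ e = + (K C e) * rowSum K g′ 0 m (a ℕ.+ e) (b ℕ.+ m ℕ.* e)

      k<B : k ℕ.< suc K ℕ.* p
      k<B = subst (ℕ._< suc K ℕ.* p) (ℕₚ.*-comm K p) (ℕₚ.m<n+m (K ℕ.* p) ℕ.z<s)

      -- The binomial gives one factor A. As p divides pa but not e, the count pa + e is not a
      -- multiple of p, and the remaining row sum gives the second factor A.
      off : ∀ e → ¬ (p ℕᵈ.∣ e) → M ∣ f e
      off e p∤e = ∣-trans M∣A² (*-pres-∣ (A∣binomial e p∤e)
        (rowSum-∣ (λ a → ¬ (p ℕᵈ.∣ a)) g (λ x y p∤x p∣y h → p∤x (ℕᵈ.∣m+n∣m⇒∣n (subst (p ℕᵈ.∣_) (ℕₚ.+-comm x y) h) p∣y))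
          A∣g m _ _ (λ h → p∤e (ℕᵈ.∣m+n∣m⇒∣n h (ℕᵈ.m∣m*n a)))))

      on : ∀ e → M ∣ f (p ℕ.* e) - ε ^ a * f′ e
      on e = subst₂ (λ u v → M ∣ x * rowSum k g 0 m u v - ε ^ a * (c * z))
        (ℕₚ.*-distribˡ-+ p a e) (sym row-shift) (subst (M ∣_) (sym split)
          (∣m∣n⇒∣m+n (∣m⇒∣m*n y (M∣binomial e))
                     (∣n⇒∣m*n (ε ^ e * c) (rowSum-transfer g A∣g m (a ℕ.+ e) (b ℕ.+ m ℕ.* e)))))
        where
        row-shift : p ℕ.* b ℕ.+ m ℕ.* (p ℕ.* e) ≡ p ℕ.* (b ℕ.+ m ℕ.* e)
        row-shift = trans (cong (p ℕ.* b ℕ.+_) (trans (sym (ℕₚ.*-assoc m p e))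
            (trans (cong (ℕ._* e) (ℕₚ.*-comm m p)) (ℕₚ.*-assoc p m e))))
          (sym (ℕₚ.*-distribˡ-+ p b (m ℕ.* e)))
        x y c z : ℤ
        x = + (k C p ℕ.* e)
        y = rowSum k g 0 m (p ℕ.* (a ℕ.+ e)) (p ℕ.* (b ℕ.+ m ℕ.* e))
        c = + (K C e)
        z = rowSum K g′ 0 m (a ℕ.+ e) (b ℕ.+ m ℕ.* e)
        signs : ε ^ a * (c * z) ≡ ε ^ e * c * (ε ^ (a ℕ.+ e) * z)
        signs = begin
          ε ^ a * (c * z)                       ≡⟨ *-identityˡ _ ⟨
          1ℤ * (ε ^ a * (c * z))                ≡⟨ cong (_* (ε ^ a * (c * z))) (ε^e²≡1 e) ⟨
          ε ^ e * ε ^ e * (ε ^ a * (c * z))     ≡⟨ lemma (ε ^ a) (ε ^ e) c z ⟩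
          ε ^ e * c * (ε ^ a * ε ^ e * z)
            ≡⟨ cong (λ s → ε ^ e * c * (s * z)) (^-distribˡ-+-* ε a e) ⟨
          ε ^ e * c * (ε ^ (a ℕ.+ e) * z)       ∎
          where
          open ≡-Reasoning
          lemma : ∀ s t c z → t * t * (s * (c * z)) ≡ t * c * (s * t * z)
          lemma = solve-∀
        split : x * y - ε ^ a * (c * z) ≡ (x - ε ^ e * c) * y + ε ^ e * c * (y - ε ^ (a ℕ.+ e) * z)
        split = trans (cong (λ w → x * y - w) signs) (lemma x y (ε ^ e * c) (ε ^ (a ℕ.+ e) * z))
          where
          lemma : ∀ x y u v → x * y - u * v ≡ (x - u) * y + u * (y - v)
          lemma = solve-∀

-- Enumeration of rows and of Frobenius symbols

module Counting where

  open import Defs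
  open import Data.Nat.Base as ℕ using (ℕ; zero; suc)
  import Data.Nat.Properties as ℕₚ
  open import Data.Fin.Base using (Fin; toℕ; fromℕ<)
  open import Data.Fin.Properties using (toℕ<n; toℕ-fromℕ<; toℕ-injective; 0↔⊥; 1↔⊤; +↔⊎; *↔×)
  open import Data.Fin.Permutation using (↔⇒≡)
  open import Data.Integer.Base using (ℤ; +_; _+_; _*_; 0ℤ; 1ℤ)
  open import Data.Integer.Properties using (pos-*)
  open import Data.List.Base using (List; []; _∷_; length; map)
  open import Data.List.Relation.Unary.Linked using ([]; [-]; _∷_; irrelevant)
  open import Data.Nat.ListAction using (sum)
  open import Data.Unit.Base using (⊤; tt)
  open import Data.Product.Base using (Σ-syntax; ∃; _×_; _,_; proj₁; proj₂)
  open import Data.Product.Function.NonDependent.Propositional using (_×-↔_)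
  open import Data.Sum.Base using (_⊎_; inj₁; inj₂)
  open import Data.Sum.Function.Propositional using (_⊎-↔_)
  open import Function.Base using (_∘_)
  open import Function.Bundles using (_↔_; mk↔ₛ′)
  open import Function.Properties.Inverse using (↔-trans; ↔-sym)
  open import Relation.Nullary using (¬_; yes; no; contradiction)
  open import Relation.Binary.PropositionalEquality
  open RowSums

  -- The cardinality is recorded as an integer to be directly comparable with the row sums.
  record HasCount (X : Set) (z : ℤ) : Set where
    constructor hasCount
    field
      size  : ℕ
      value≡ : + size ≡ z
      enum  : Fin size ↔ X

  -- Links an arbitrary enumeration, as given in the theorem, to the computed cardinality.
  count-unique : ∀ {X a z} → Fin a ↔ X → HasCount X z → + a ≡ z
  count-unique f (hasCount s eq g) = trans (cong +_ (↔⇒≡ (↔-trans f (↔-sym g)))) eq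

  count-↔ : ∀ {X Y z} → X ↔ Y → HasCount X z → HasCount Y z
  count-↔ f (hasCount s eq g) = hasCount s eq (↔-trans g f)

  count-⊎ : ∀ {X Y x y} → HasCount X x → HasCount Y y → HasCount (X ⊎ Y) (x + y)
  count-⊎ (hasCount s refl f) (hasCount t refl g) = hasCount (s ℕ.+ t) refl (↔-trans +↔⊎ (f ⊎-↔ g))

  count-× : ∀ {X Y x y} → HasCount X x → HasCount Y y → HasCount (X × Y) (x * y)
  count-× (hasCount s refl f) (hasCount t refl g) =
    hasCount (s ℕ.* t) (pos-* s t) (↔-trans *↔× (f ×-↔ g))

  count-∅ : ∀ {X : Set} → ¬ X → HasCount X 0ℤ
  count-∅ ¬x = hasCount 0 refl
    (↔-trans 0↔⊥ (mk↔ₛ′ (λ ()) ¬x (λ x → contradiction x ¬x) (λ ())))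

  count-Σ : ∀ B {P : ℕ → Set} {f : ℕ → ℤ} → (∀ i → i ℕ.< B → HasCount (P i) (f i)) →
    (∀ i → B ℕ.≤ i → ¬ P i) → HasCount (∃ P) (Σ< B f)
  count-Σ zero    _ empty = count-∅ (λ (i , Pi) → empty i ℕ.z≤n Pi)
  count-Σ (suc B) {P} count empty = count-↔ headTail
    (count-⊎ (count 0 ℕ.z<s) (count-Σ B (λ i → count (suc i) ∘ ℕ.s<s) (λ i → empty (suc i) ∘ ℕ.s≤s)))
    where
    headTail : (P 0 ⊎ ∃ (P ∘ suc)) ↔ ∃ P
    headTail = mk↔ₛ′
      (λ { (inj₁ x) → 0 , x ; (inj₂ (i , x)) → suc i , x })
      (λ { (zero , x) → inj₁ x ; (suc i , x) → inj₂ (i , x) })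
      (λ { (zero , x) → refl ; (suc i , x) → refl })
      (λ { (inj₁ x) → refl ; (inj₂ (i , x)) → refl })

  δ : ℕ → ℕ → ℤ
  δ i j with i ℕₚ.≟ j
  ... | yes _ = 1ℤ
  ... | no  _ = 0ℤ

  δ-yes : ∀ {i j} → i ≡ j → δ i j ≡ 1ℤ
  δ-yes {i} {j} eq with i ℕₚ.≟ j
  ... | yes _ = refl
  ... | no ne = contradiction eq ne

  δ-no : ∀ {i j} → ¬ i ≡ j → δ i j ≡ 0ℤ
  δ-no {i} {j} ne with i ℕₚ.≟ j
  ... | yes eq = contradiction eq ne
  ... | no _   = refl

  count-≡ : ∀ i j → HasCount (i ≡ j) (δ i j)
  count-≡ i j with i ℕₚ.≟ j
  ... | no ne = count-∅ ne
  ... | yes refl = hasCount 1 refl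
    (↔-trans 1↔⊤ (mk↔ₛ′ (λ _ → refl) (λ _ → tt) (λ eq → ℕₚ.≡-irrelevant refl eq) (λ _ → refl)))

  -- The colour bound is a natural number, so that c = k can express that all colours of value m are
  -- allowed. When c is `toℕ` of a colour, this unfolds to `_≺_`.
  Precedes : ∀ {k} → ℕ → ℕ → CNat k → Set
  Precedes c m (ℓ , x) = ℓ ℕ.< m ⊎ (ℓ ≡ m × toℕ x ℕ.< c)

  -- Strictly decreasing lists all of whose entries precede the entry of value m and (0-based) colour c.
  Descending : ∀ {k} → ℕ → ℕ → List (CNat k) → Set
  Descending c m []             = ⊤
  Descending c m ((ℓ , x) ∷ xs) = Precedes c m (ℓ , x) × Descending (toℕ x) ℓ xs

  precedes-irrelevant : ∀ {k} c m (y : CNat k) (u v : Precedes c m y) → u ≡ v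
  precedes-irrelevant c m y (inj₁ u) (inj₁ v) = cong inj₁ (ℕₚ.<-irrelevant u v)
  precedes-irrelevant c m y (inj₁ u) (inj₂ (refl , _)) = contradiction u (ℕₚ.<-irrefl refl)
  precedes-irrelevant c m y (inj₂ (refl , _)) (inj₁ v) = contradiction v (ℕₚ.<-irrefl refl)
  precedes-irrelevant c m y (inj₂ (p , u)) (inj₂ (q , v)) =
    cong₂ (λ a b → inj₂ (a , b)) (ℕₚ.≡-irrelevant p q) (ℕₚ.<-irrelevant u v)

  descending-irrelevant : ∀ {k} c m (xs : List (CNat k)) (u v : Descending c m xs) → u ≡ v
  descending-irrelevant c m []             u v = refl
  descending-irrelevant c m ((ℓ , x) ∷ xs) (u , us) (v , vs) =
    cong₂ _,_ (precedes-irrelevant c m (ℓ , x) u v) (descending-irrelevant (toℕ x) ℓ xs us vs)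

  linked⇒descending : ∀ {k} ℓ (x : Fin k) xs → StrictlyDecreasing ((ℓ , x) ∷ xs) → Descending (toℕ x) ℓ xs
  linked⇒descending ℓ x []             [-]      = tt
  linked⇒descending ℓ x ((ℓ′ , y) ∷ xs) (r ∷ rs) = r , linked⇒descending ℓ′ y xs rs

  descending⇒linked : ∀ {k} ℓ (x : Fin k) xs → Descending (toℕ x) ℓ xs → StrictlyDecreasing ((ℓ , x) ∷ xs)
  descending⇒linked ℓ x []              _        = [-]
  descending⇒linked ℓ x ((ℓ′ , y) ∷ xs) (r , rs) = r ∷ descending⇒linked ℓ′ y xs rs

  -- The offsets a and b account for entries already taken from the front of the row, as do the
  -- accumulators of `rowSum`.
  Restricted : ∀ {k} → (List (CNat k) → Set) → (a b d n : ℕ) → Set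
  Restricted {k} P a b d n =
    Σ[ xs ∈ List (CNat k) ] (P xs × a ℕ.+ length xs ≡ d × b ℕ.+ sum (map value xs) ≡ n)

  restricted-≡ : ∀ {k} {P : List (CNat k) → Set} {a b d n} → (∀ xs (u v : P xs) → u ≡ v) →
    {r s : Restricted P a b d n} → proj₁ r ≡ proj₁ s → r ≡ s
  restricted-≡ irr {xs , u , l , s} {_ , u′ , l′ , s′} refl
    rewrite irr xs u u′ | ℕₚ.≡-irrelevant l l′ | ℕₚ.≡-irrelevant s s′ = refl

  restricted-↔ : ∀ {k} {P Q : List (CNat k) → Set} {a b d n} →
    (∀ xs (u v : P xs) → u ≡ v) → (∀ xs (u v : Q xs) → u ≡ v) →
    (∀ xs → b ℕ.+ sum (map value xs) ≡ n → P xs → Q xs) → (∀ xs → Q xs → P xs) →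
    Restricted P a b d n ↔ Restricted Q a b d n
  restricted-↔ irrP irrQ P⇒Q Q⇒P = mk↔ₛ′
    (λ (xs , u , l , s) → xs , P⇒Q xs s u , l , s)
    (λ (xs , u , l , s) → xs , Q⇒P xs u , l , s)
    (λ _ → restricted-≡ irrQ refl) (λ _ → restricted-≡ irrP refl)

  Row : (k c m a b d n : ℕ) → Set
  Row k c m = Restricted (Descending {k} c m)

  row-≡ : ∀ {k c m a b d n} {r s : Row k c m a b d n} → proj₁ r ≡ proj₁ s → r ≡ s
  row-≡ = restricted-≡ (descending-irrelevant _ _)

  -- Nothing precedes the entry of value 0 and colour 0, so the list must be empty.
  row-empty : ∀ k a b d n → (a ≡ d × b ≡ n) ↔ Row k 0 0 a b d n
  row-empty k a b d n = mk↔ₛ′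
    (λ (l , s) → [] , tt , trans (ℕₚ.+-identityʳ a) l , trans (ℕₚ.+-identityʳ b) s)
    (λ { ([] , tt , l , s) → trans (sym (ℕₚ.+-identityʳ a)) l , trans (sym (ℕₚ.+-identityʳ b)) s
       ; (_ ∷ _ , (inj₁ () , _) , _) ; (_ ∷ _ , (inj₂ (_ , ()) , _) , _) })
    (λ { ([] , tt , l , s) → row-≡ refl
       ; (_ ∷ _ , (inj₁ () , _) , _) ; (_ ∷ _ , (inj₂ (_ , ()) , _) , _) })
    (λ (l , s) → cong₂ _,_ (ℕₚ.≡-irrelevant _ l) (ℕₚ.≡-irrelevant _ s))

  -- All colours are below k, so both bounds say that the values are at most m.
  row-level : ∀ k m a b d n → Row k k m a b d n ↔ Row k 0 (suc m) a b d n
  row-level k m a b d n = restricted-↔ (descending-irrelevant _ _) (descending-irrelevant _ _)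
    (λ xs _ → down xs) up
    where
    down : ∀ xs → Descending k m xs → Descending 0 (suc m) xs
    down []      _                    = tt
    down (_ ∷ _) (inj₁ ℓ<m , D)        = inj₁ (ℕₚ.m<n⇒m<1+n ℓ<m) , D
    down (_ ∷ _) (inj₂ (refl , _) , D) = inj₁ (ℕₚ.n<1+n m) , D
    up : ∀ xs → Descending 0 (suc m) xs → Descending k m xs
    up []             _                  = tt
    up (_ ∷ _)        (inj₂ (_ , ()) , _)
    up ((ℓ , x) ∷ xs) (inj₁ ℓ<1+m , D) with ℕₚ.m<1+n⇒m<n∨m≡n ℓ<1+m
    ... | inj₁ ℓ<m = inj₁ ℓ<m , D
    ... | inj₂ ℓ≡m = inj₂ (ℓ≡m , toℕ<n x) , D

  module _ {k c : ℕ} (c<k : c ℕ.< k) (m a b d n : ℕ) where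

    private
      color : Fin k
      color = fromℕ< c<k

      prepend : Row k c m a b d n ⊎ Row k c m (suc a) (b ℕ.+ m) d n → Row k (suc c) m a b d n
      prepend (inj₁ ([] , r)) = [] , r
      prepend (inj₁ (x ∷ xs , (inj₁ ℓ<m , D) , r)) = x ∷ xs , (inj₁ ℓ<m , D) , r
      prepend (inj₁ (x ∷ xs , (inj₂ (eq , x<c) , D) , r)) = x ∷ xs , (inj₂ (eq , ℕₚ.m<n⇒m<1+n x<c) , D) , r
      prepend (inj₂ (xs , D , l , s)) = (m , color) ∷ xs ,
        (inj₂ (refl , subst (ℕ._< suc c) (sym (toℕ-fromℕ< c<k)) (ℕₚ.n<1+n c)) ,
         subst (λ i → Descending i m xs) (sym (toℕ-fromℕ< c<k)) D) ,
        trans (ℕₚ.+-suc a (length xs)) l , trans (sym (ℕₚ.+-assoc b m _)) s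

      behead : Row k (suc c) m a b d n → Row k c m a b d n ⊎ Row k c m (suc a) (b ℕ.+ m) d n
      behead ([] , r) = inj₁ ([] , r)
      behead (x ∷ xs , (inj₁ ℓ<m , D) , r) = inj₁ (x ∷ xs , (inj₁ ℓ<m , D) , r)
      behead ((_ , x) ∷ xs , (inj₂ (refl , x<1+c) , D) , l , s) with ℕₚ.m<1+n⇒m<n∨m≡n x<1+c
      ... | inj₁ x<c = inj₁ ((m , x) ∷ xs , (inj₂ (refl , x<c) , D) , l , s)
      ... | inj₂ x≡c = inj₂ (xs , subst (λ i → Descending i m xs) x≡c D ,
              trans (sym (ℕₚ.+-suc a (length xs))) l , trans (ℕₚ.+-assoc b m _) s)

      prepend-behead : ∀ r → prepend (behead r) ≡ r
      prepend-behead ([] , r) = refl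
      prepend-behead (x ∷ xs , (inj₁ ℓ<m , D) , r) = refl
      prepend-behead ((_ , x) ∷ xs , (inj₂ (refl , x<1+c) , D) , l , s) with ℕₚ.m<1+n⇒m<n∨m≡n x<1+c
      ... | inj₁ x<c = row-≡ refl
      ... | inj₂ x≡c = row-≡ (cong (λ y → (m , y) ∷ xs)
              (toℕ-injective (trans (toℕ-fromℕ< c<k) (sym x≡c))))

      behead-prepend : ∀ r → behead (prepend r) ≡ r
      behead-prepend (inj₁ ([] , r)) = refl
      behead-prepend (inj₁ (x ∷ xs , (inj₁ ℓ<m , D) , r)) = refl
      behead-prepend (inj₁ ((_ , x) ∷ xs , (inj₂ (refl , x<c) , D) , r))
        with ℕₚ.m<1+n⇒m<n∨m≡n (ℕₚ.m<n⇒m<1+n x<c)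
      ... | inj₁ _   = cong inj₁ (row-≡ refl)
      ... | inj₂ x≡c = contradiction x<c (ℕₚ.<-irrefl x≡c)
      behead-prepend (inj₂ (xs , D , l , s))
        with ℕₚ.m<1+n⇒m<n∨m≡n (subst (ℕ._< suc c) (sym (toℕ-fromℕ< c<k)) (ℕₚ.n<1+n c))
      ... | inj₁ x<c = contradiction x<c (ℕₚ.<-irrefl (toℕ-fromℕ< c<k))
      ... | inj₂ _   = cong inj₂ (row-≡ refl)

    -- A row below colour c + 1 of value m is either below colour c already or starts with the entry
    -- of value m and colour c; `rowSum` recurses in the same way.
    row-color : (Row k c m a b d n ⊎ Row k c m (suc a) (b ℕ.+ m) d n) ↔ Row k (suc c) m a b d n
    row-color = mk↔ₛ′ prepend behead prepend-behead behead-prepend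

  -- As the function summed by `rowSum`, this selects the rows with d entries and value sum n.
  target : ℕ → ℕ → ℕ → ℕ → ℤ
  target d n a b = δ a d * δ b n

  count-row : ∀ k d n c m a b → c ℕ.≤ k → HasCount (Row k c m a b d n) (rowSum k (target d n) c m a b)
  count-row k d n zero    zero    a b _   = count-↔ (row-empty k a b d n) (count-× (count-≡ a d) (count-≡ b n))
  count-row k d n zero    (suc m) a b _   = count-↔ (row-level k m a b d n) (count-row k d n k m a b ℕₚ.≤-refl)
  count-row k d n (suc c) m       a b c<k = count-↔ (row-color c<k m a b d n)
    (count-⊎ (count-row k d n c m a b (ℕₚ.<⇒≤ c<k)) (count-row k d n c m (suc a) (b ℕ.+ m) (ℕₚ.<⇒≤ c<k)))

  rows : ℕ → ℕ → ℕ → ℕ → ℤ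
  rows k m d n = rowSum k (target d n) 0 m 0 0

  -- Each value is at most the sum n, so a value bound m > n admits every decreasing row.
  count-decreasing : ∀ k m d n → n ℕ.< m → HasCount (Restricted (StrictlyDecreasing {k}) 0 0 d n) (rows k m d n)
  count-decreasing k m d n n<m = count-↔
    (↔-sym (restricted-↔ decreasing-irrelevant (descending-irrelevant _ _) to from))
    (count-row k d n 0 m 0 0 ℕ.z≤n)
    where
    decreasing-irrelevant : ∀ xs (u v : StrictlyDecreasing {k} xs) → u ≡ v
    decreasing-irrelevant _ = irrelevant (λ {y} {x} → precedes-irrelevant (toℕ (proj₂ y)) (proj₁ y) x)
    to : ∀ xs → sum (map value xs) ≡ n → StrictlyDecreasing xs → Descending 0 m xs
    to []             _ _  = tt
    to ((ℓ , x) ∷ xs) s ds = inj₁ (ℕₚ.≤-<-trans (ℕₚ.≤-trans (ℕₚ.m≤m+n ℓ _) (ℕₚ.≤-reflexive s)) n<m) ,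
      linked⇒descending ℓ x xs ds
    from : ∀ xs → Descending 0 m xs → StrictlyDecreasing xs
    from []             _       = []
    from ((ℓ , x) ∷ xs) (_ , D) = descending⇒linked ℓ x xs D

  SplitCPhi : ℕ → ℕ → Set
  SplitCPhi k n = ∃ λ d → ∃ λ i → ∃ λ j → (d ℕ.+ (i ℕ.+ j) ≡ n) ×
    (Restricted (StrictlyDecreasing {k}) 0 0 d i × Restricted (StrictlyDecreasing {k}) 0 0 d j)

  splitCPhi-↔ : ∀ k n → SplitCPhi k n ↔ CPhi k n
  splitCPhi-↔ k n = mk↔ₛ′
    (λ { (_ , _ , _ , w , (t , td , refl , refl) , (b , bd , lb , refl)) → frob t b (sym lb) td bd , w })
    (λ { (frob t b lt td bd , w) →
         length t , sum (map value t) , sum (map value b) , w , (t , td , refl , refl) , (b , bd , sym lt , refl) })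
    (λ { (frob t b lt td bd , w) → cong (λ e → frob t b e td bd , w) (ℕₚ.≡-irrelevant (sym (sym lt)) lt) })
    (λ { (_ , _ , _ , w , (t , td , refl , refl) , (b , bd , lb , refl)) →
         cong (λ e → length t , sum (map value t) , sum (map value b) , w , (t , td , refl , refl) , (b , bd , e , refl))
           (ℕₚ.≡-irrelevant (sym (sym lb)) lb) })

  -- Each of d, i and j is at most n, so the ranges may stop at any B > n. B and m stay free so that
  -- B can be a multiple of p and m can be common to both numbers of colours.
  count-CPhi : ∀ k n B m → n ℕ.< B → B ℕ.≤ m → HasCount (CPhi k n)
    (Σ[ d < B ] pairSum B (λ i j → δ (d ℕ.+ (i ℕ.+ j)) n) (rows k m d))
  count-CPhi k n B m n<B B≤m = count-↔ (splitCPhi-↔ k n)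
    (count-Σ B (λ d _ → count-Σ B (λ i i<B → count-Σ B (λ j j<B →
        count-× (count-≡ _ n) (count-× (count-decreasing k m d i (ℕₚ.<-≤-trans i<B B≤m))
                                       (count-decreasing k m d j (ℕₚ.<-≤-trans j<B B≤m))))
      (λ j B≤j (w , _) → too-big B≤j (ℕₚ.≤-trans (ℕₚ.m≤n+m j i) (ℕₚ.m≤n+m (i ℕ.+ j) d)) w))
      (λ i B≤i (j , w , _) → too-big B≤i (ℕₚ.≤-trans (ℕₚ.m≤m+n i j) (ℕₚ.m≤n+m (i ℕ.+ j) d)) w))
      (λ d B≤d (i , j , w , _) → too-big B≤d (ℕₚ.m≤m+n d (i ℕ.+ j)) w))
    where
    too-big : ∀ {x s} → B ℕ.≤ x → x ℕ.≤ s → ¬ s ≡ n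
    too-big B≤x x≤s refl = ℕₚ.<⇒≱ n<B (ℕₚ.≤-trans B≤x x≤s)

-- Congruences between the numbers of symbols

module Congruences where

  open import Defs
  open import Data.Nat.Base as ℕ using (ℕ; zero; suc)
  import Data.Nat.Properties as ℕₚ
  import Data.Nat.Divisibility as ℕᵈ
  open import Data.Nat.Primality using (Prime; ¬prime[0]; prime⇒irreducible)
  open import Data.Nat.Combinatorics using (_C_)
  open import Data.Fin.Base using (Fin)
  open import Data.Integer.Base hiding (suc; pred; ∣_∣)
  open import Data.Integer.Properties hiding (suc-+; pred-suc)
  open import Data.Integer.Divisibility.Signed
  open import Data.Integer.Tactic.RingSolver using (solve-∀)
  open import Data.Product.Base using (∃; _,_)
  open import Data.Sum.Base using (_⊎_; inj₁; inj₂)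
  open import Function.Base using (_∘_)
  open import Function.Bundles using (_↔_)
  open import Relation.Nullary using (¬_; yes; no; contradiction)
  open import Relation.Binary.PropositionalEquality
  open Binomials
  open RowSums
  open Counting

  δ-cong : ∀ {i j i′ j′} → (i ≡ j → i′ ≡ j′) → (i′ ≡ j′ → i ≡ j) → δ i j ≡ δ i′ j′
  δ-cong {i} {j} to from with i ℕₚ.≟ j
  ... | yes eq = sym (δ-yes (to eq))
  ... | no  ne = sym (δ-no (ne ∘ from))

  δ-* : ∀ p₁ i j → δ (suc p₁ ℕ.* i) (suc p₁ ℕ.* j) ≡ δ i j
  δ-* p₁ i j = δ-cong (ℕₚ.*-cancelˡ-≡ i j (suc p₁)) (cong (suc p₁ ℕ.*_))

  δ*-∣ : ∀ {T} i j x → ¬ i ≡ j → T ∣ δ i j * x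
  δ*-∣ {T} i j x i≢j = subst (λ z → T ∣ z * x) (sym (δ-no i≢j)) (subst (T ∣_) (sym (*-zeroˡ x)) ∣0)

  module Congruence
    (p₁ K : ℕ) (ε A M : ℤ) (ε²≡1 : ε * ε ≡ 1ℤ) (M∣A² : M ∣ A * A)
    (A²∣2M : A * A ∣ M + M) (A²∣M² : A * A ∣ M * M)
    (A∣binomial : ∀ e → ¬ (suc p₁ ℕᵈ.∣ e) → A ∣ + (suc p₁ ℕ.* K C e))
    (M∣binomial : ∀ e → M ∣ + (suc p₁ ℕ.* K C suc p₁ ℕ.* e) - ε ^ e * + (K C e))
    where

    private
      p = suc p₁
      k = p ℕ.* K

    open Transfer p₁ K ε A M ε²≡1 M∣A² A∣binomial M∣binomial

    -- If all multiplicities were divisible by p, so would be the length d; hence some binomial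
    -- supplies A.
    rows-∣ : ∀ m d j → ¬ (p ℕᵈ.∣ d) → A ∣ rows k m d j
    rows-∣ m d j p∤d = rowSum-∣ (p ℕᵈ.∣_) (target d j) (λ _ _ → ℕᵈ.∣m∣n⇒∣m+n)
      (λ a b p∣a → δ*-∣ a d (δ b j) λ { refl → p∤d p∣a }) m 0 0 (p ℕᵈ.∣0)

    -- The K-coloured counterpart of `rows k m (p d)`. It is a function of every j, not only of
    -- multiples of p, so that `symmetric-form` can compare the two over one range.
    reduced : ℕ → ℕ → ℕ → ℤ
    reduced m d j = rowSum K (λ a b → ε ^ a * target (p ℕ.* d) j (p ℕ.* a) (p ℕ.* b)) 0 m 0 0

    rows-reduced : ∀ m d j → M ∣ rows k m (p ℕ.* d) j - reduced m d j
    rows-reduced m d j = subst₂ (λ x y → M ∣ x - y)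
      (cong₂ (rowSum k (target (p ℕ.* d) j) 0 m) (ℕₚ.*-zeroʳ p) (ℕₚ.*-zeroʳ p)) (*-identityˡ (reduced m d j))
      (rowSum-transfer (target (p ℕ.* d) j)
        (λ a b p∤a → δ*-∣ a (p ℕ.* d) (δ b j) λ { refl → p∤a (ℕᵈ.m∣m*n d) }) m 0 0)

    reduced-multiple : ∀ m d j → reduced m d (p ℕ.* j) ≡ ε ^ d * rows K m d j
    reduced-multiple m d j = rowSum-scale K (ε ^ d) base 0 m 0 0
      where
      base : ∀ a b → ε ^ a * target (p ℕ.* d) (p ℕ.* j) (p ℕ.* a) (p ℕ.* b) ≡ ε ^ d * target d j a b
      base a b = trans (cong (ε ^ a *_) (cong₂ _*_ (δ-* p₁ a d) (δ-* p₁ b j))) (signs a)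
        where
        signs : ∀ a → ε ^ a * (δ a d * δ b j) ≡ ε ^ d * (δ a d * δ b j)
        signs a with a ℕₚ.≟ d
        ... | yes refl = refl
        ... | no _     = trans (*-zeroʳ (ε ^ a)) (sym (*-zeroʳ (ε ^ d)))

    reduced-nonmultiple : ∀ m d j → ¬ (p ℕᵈ.∣ j) → reduced m d j ≡ 0ℤ
    -- Scaling by 0 shows that the row sum of the zero function vanishes.
    reduced-nonmultiple m d j p∤j = trans (rowSum-scale K 0ℤ {h = λ _ _ → 0ℤ} base 0 m 0 0)
      (*-zeroˡ (rowSum K (λ _ _ → 0ℤ) 0 m 0 0))
      where
      base : ∀ a b → ε ^ a * target (p ℕ.* d) j (p ℕ.* a) (p ℕ.* b) ≡ 0ℤ * 0ℤ
      base a b = trans (cong (λ z → ε ^ a * (δ (p ℕ.* a) (p ℕ.* d) * z))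
                         (δ-no λ { refl → p∤j (ℕᵈ.m∣m*n b) }))
        (trans (cong (ε ^ a *_) (*-zeroʳ (δ (p ℕ.* a) (p ℕ.* d)))) (*-zeroʳ (ε ^ a)))

    -- `weight≡/p` tests p(d + i + j) = n without dividing n by p, so it also covers the n that p
    -- does not divide, where it is zero.
    weight≡ weight≡/p : (n d i j : ℕ) → ℤ
    weight≡   n d i j = δ (d ℕ.+ (i ℕ.+ j)) n
    weight≡/p n d i j = δ (p ℕ.* d ℕ.+ (p ℕ.* i ℕ.+ p ℕ.* j)) n

    -- Indices that p does not divide contribute 0, and in the remaining products the sign ε^d
    -- occurs twice.
    reduced-pairs : ∀ n m L d →
      A * A ∣ pairSum (L ℕ.* p) (weight≡ n (p ℕ.* d)) (reduced m d) - pairSum L (weight≡/p n d) (rows K m d)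
    reduced-pairs n m L d = Σ<-multiples p₁ L
      (λ i → Σ[ j < L ℕ.* p ] (w i j * (r i * r j)))
      (λ i → Σ[ j < L ] (weight≡/p n d i j * (rows K m d i * rows K m d j)))
      (λ i p∤i → Σ<-∣ (L ℕ.* p) λ j _ → ∣n⇒∣m*n (w i j) (∣m⇒∣m*n (r j) (r-∣ i p∤i)))
      (λ i → Σ<-multiples p₁ L
        (λ j → w (p ℕ.* i) j * (r (p ℕ.* i) * r j))
        (λ j → weight≡/p n d i j * (rows K m d i * rows K m d j))
        (λ j p∤j → ∣n⇒∣m*n (w (p ℕ.* i) j) (∣n⇒∣m*n (r (p ℕ.* i)) (r-∣ j p∤j)))
        (λ j → ≡⇒∣- (cong (weight≡/p n d i j *_) (signs i j))))
      where
      w = weight≡ n (p ℕ.* d)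
      r = reduced m d
      r-∣ : ∀ j → ¬ (p ℕᵈ.∣ j) → A * A ∣ r j
      r-∣ j p∤j = subst (A * A ∣_) (sym (reduced-nonmultiple m d j p∤j)) ∣0
      signs : ∀ i j → r (p ℕ.* i) * r (p ℕ.* j) ≡ rows K m d i * rows K m d j
      signs i j = begin
        r (p ℕ.* i) * r (p ℕ.* j)
          ≡⟨ cong₂ _*_ (reduced-multiple m d i) (reduced-multiple m d j) ⟩
        ε ^ d * rows K m d i * (ε ^ d * rows K m d j)
          ≡⟨ lemma (ε ^ d) (rows K m d i) (rows K m d j) ⟩
        ε ^ d * ε ^ d * (rows K m d i * rows K m d j)
          ≡⟨ cong (_* (rows K m d i * rows K m d j)) (ε^e²≡1 d) ⟩
        1ℤ * (rows K m d i * rows K m d j)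
          ≡⟨ *-identityˡ (rows K m d i * rows K m d j) ⟩
        rows K m d i * rows K m d j ∎
        where
        open ≡-Reasoning
        lemma : ∀ x y z → x * y * (x * z) ≡ x * x * (y * z)
        lemma = solve-∀

    -- For p ∤ d both row sums carry a factor A. For the other d, `rows` and `reduced` agree modulo
    -- M, which the symmetric quadratic form improves to A².
    pairs-congruence : ∀ n m L →
      A * A ∣ Σ[ d < L ℕ.* p ] pairSum (L ℕ.* p) (weight≡ n d) (rows k m d)
            - Σ[ d < L ] pairSum L (weight≡/p n d) (rows K m d)
    pairs-congruence n m L = Σ<-multiples p₁ L
      (λ d → pairSum B (weight≡ n d) (rows k m d))
      (λ d → pairSum L (weight≡/p n d) (rows K m d))
      (λ d p∤d → Σ<-∣ B λ i _ → Σ<-∣ B λ j _ →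
        ∣n⇒∣m*n (weight≡ n d i j) (*-pres-∣ (rows-∣ m d i p∤d) (rows-∣ m d j p∤d)))
      (λ d → ∣-transitive
        (pairSum B (weight≡ n (p ℕ.* d)) (rows k m (p ℕ.* d)))
        (pairSum B (weight≡ n (p ℕ.* d)) (reduced m d))
        (pairSum L (weight≡/p n d) (rows K m d))
        (symmetric-form A²∣2M A²∣M² B (weight≡ n (p ℕ.* d))
          (λ i j → cong (λ s → δ (p ℕ.* d ℕ.+ s) n) (ℕₚ.+-comm i j))
          (rows k m (p ℕ.* d)) (reduced m d) (rows-reduced m d))
        (reduced-pairs n m L d))
      where
      B = L ℕ.* p

    cφ-multiple : ∀ m a b → Fin a ↔ CPhi k (p ℕ.* m) → Fin b ↔ CPhi K m → A * A ∣ + a - + b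
    cφ-multiple m a b f g = subst₂ (λ x y → A * A ∣ x - y)
      (sym (count-unique f (count-CPhi k n B B n<B ℕₚ.≤-refl)))
      -- The K-coloured count runs over d, i, j ≤ m but uses the value bound B of the k-coloured
      -- one.
      (sym (trans (count-unique g (count-CPhi K m (suc m) B (ℕₚ.n<1+n m) (ℕₚ.m≤m*n (suc m) p)))
        (Σ<-cong (suc m) λ d → Σ<Σ<-cong (suc m) λ i j →
          cong (_* (rows K B d i * rows K B d j)) (sym (trans (cong (λ z → δ z n) (factor-p d i j)) (δ-* p₁ _ m))))))
      (pairs-congruence n B (suc m))
      where
      n = p ℕ.* m
      B = suc m ℕ.* p
      n<B : n ℕ.< B
      n<B = subst (ℕ._< B) (ℕₚ.*-comm m p) (ℕₚ.m<n+m (m ℕ.* p) ℕ.z<s)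
      factor-p : ∀ d i j → p ℕ.* d ℕ.+ (p ℕ.* i ℕ.+ p ℕ.* j) ≡ p ℕ.* (d ℕ.+ (i ℕ.+ j))
      factor-p d i j = trans (cong (p ℕ.* d ℕ.+_) (sym (ℕₚ.*-distribˡ-+ p i j))) (sym (ℕₚ.*-distribˡ-+ p d (i ℕ.+ j)))

    -- No p(d + i + j) equals n, so every term of the K-coloured sum is zero.
    cφ-nonmultiple : ∀ n a → ¬ (p ℕᵈ.∣ n) → Fin a ↔ CPhi k n → A * A ∣ + a
    cφ-nonmultiple n a p∤n f = subst (A * A ∣_) (sym (count-unique f (count-CPhi k n B B n<B ℕₚ.≤-refl)))
      (∣m+n∣n⇒∣m (pairs-congruence n B (suc n)) (∣m⇒∣-m (Σ<-∣ (suc n) λ d _ → Σ<-∣ (suc n) λ i _ → Σ<-∣ (suc n) λ j _ →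
        δ*-∣ (p ℕ.* d ℕ.+ (p ℕ.* i ℕ.+ p ℕ.* j)) n (rows K B d i * rows K B d j) λ { refl → p∤n (multiple d i j) })))
      where
      B = suc n ℕ.* p
      n<B : n ℕ.< B
      n<B = ℕₚ.m≤m*n (suc n) p
      multiple : ∀ d i j → p ℕᵈ.∣ p ℕ.* d ℕ.+ (p ℕ.* i ℕ.+ p ℕ.* j)
      multiple d i j = ℕᵈ.∣m∣n⇒∣m+n (ℕᵈ.m∣m*n d) (ℕᵈ.∣m∣n⇒∣m+n (ℕᵈ.m∣m*n i) (ℕᵈ.m∣m*n j))

  -- For n = p - 1 this says that ε = 1 or p is even.
  even-or-suc-even : ∀ n → (-1ℤ ^ n ≡ 1ℤ) ⊎ (2 ℕᵈ.∣ suc n)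
  even-or-suc-even zero          = inj₁ refl
  even-or-suc-even (suc zero)    = inj₂ (ℕᵈ.divides 1 refl)
  even-or-suc-even (suc (suc n)) with even-or-suc-even n
  ... | inj₁ eq = inj₁ (cong (λ x → -1ℤ * (-1ℤ * x)) eq)
  ... | inj₂ 2∣1+n = inj₂ (ℕᵈ.∣m∣n⇒∣m+n {m = 2} ℕᵈ.∣-refl 2∣1+n)

  square-sign : ∀ n → -1ℤ ^ n * -1ℤ ^ n ≡ 1ℤ
  square-sign zero    = refl
  square-sign (suc n) = trans (lemma (-1ℤ ^ n)) (square-sign n)
    where
    lemma : ∀ x → -1ℤ * x * (-1ℤ * x) ≡ x * x
    lemma = solve-∀

  -- Choice of the modulus for odd p and for p = 2

  module _ (p₁ β N : ℕ) (p-prime : Prime (suc p₁)) where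

    private
      p = suc p₁
      K = p ℕ.^ β ℕ.* N
      A = + (p ℕ.^ suc β)
      open Quotient p₁ using (ε; nonmultiple-binomial; multiple-binomial-even; multiple-binomial-weak)

    -- The conditions are met by M = A² if ε = 1, and by M = A²/2 if p = 2.
    record Modulus (M : ℤ) : Set where
      constructor modulus
      field
        M∣A²  : M ∣ A * A
        A²∣2M : A * A ∣ M + M
        A²∣M² : A * A ∣ M * M
        M∣binomial : ∀ e → M ∣ + (p ℕ.* K C p ℕ.* e) - ε ^ e * + (K C e)

    odd-modulus : ε ≡ 1ℤ → Modulus (A * A)
    odd-modulus ε≡1 = modulus ∣-refl (∣m∣n⇒∣m+n ∣-refl ∣-refl) (∣m⇒∣m*n (A * A) ∣-refl) λ e →
      subst (_∣ + (p ℕ.* K C p ℕ.* e) - ε ^ e * + (K C e)) (pos-^-+ p (suc β) (suc β))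
        (multiple-binomial-even p-prime β K (ℕᵈ.m∣m*n N) e (trans (cong (_^ e) ε≡1) (^-zeroˡ e)))

    even-modulus : p ≡ 2 → Modulus (+ (p ℕ.^ (β ℕ.+ suc β)))
    even-modulus refl = modulus (divides (+ 2) A²≡2M) (∣-reflexive A²≡M+M) A²∣M² congruence
      where
      M = + (2 ℕ.^ (β ℕ.+ suc β))
      A²≡2M : A * A ≡ + 2 * M
      A²≡2M = trans (sym (pos-^-+ 2 (suc β) (suc β))) (pos-* 2 (2 ℕ.^ (β ℕ.+ suc β)))
      A²≡M+M : A * A ≡ M + M
      A²≡M+M = trans A²≡2M (lemma M)
        where
        lemma : ∀ x → + 2 * x ≡ x + x
        lemma = solve-∀
      A²∣M² : A * A ∣ M * M
      -- M = 2^β A.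
      A²∣M² = divides (+ (2 ℕ.^ β) * + (2 ℕ.^ β))
        (trans (cong₂ _*_ (pos-^-+ 2 β (suc β)) (pos-^-+ 2 β (suc β))) (lemma (+ (2 ℕ.^ β)) A))
        where
        lemma : ∀ x y → x * y * (x * y) ≡ x * x * (y * y)
        lemma = solve-∀
      congruence : ∀ e → M ∣ + (2 ℕ.* K C 2 ℕ.* e) - -1ℤ ^ e * + (K C e)
      -- For even e the sign is 1 and the congruence holds modulo 2M = 2^(2α); odd e get it modulo
      -- M.
      congruence e with 2 ℕᵈ.∣? e
      ... | no 2∤e = multiple-binomial-weak p-prime β K (ℕᵈ.m∣m*n N) e 2∤e
      ... | yes (ℕᵈ.divides q refl) = ∣-trans (divides (+ 2) (pos-* 2 (2 ℕ.^ (β ℕ.+ suc β))))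
        (multiple-binomial-even p-prime β K (ℕᵈ.m∣m*n N) (q ℕ.* 2)
          (trans (cong (-1ℤ ^_) (ℕₚ.*-comm q 2)) (trans (sym (^-*-assoc -1ℤ 2 q)) (^-zeroˡ q))))

    ∃-modulus : ∃ Modulus
    ∃-modulus with even-or-suc-even p₁
    ... | inj₁ ε≡1 = _ , odd-modulus ε≡1
    ... | inj₂ 2∣p with prime⇒irreducible p-prime 2∣p
    ...   | inj₁ ()
    ...   | inj₂ 2≡p = _ , even-modulus (sym 2≡p)

    open Modulus

    module cφ (M : ℤ) (h : Modulus M) = Congruence p₁ K ε A M (square-sign p₁)
      (M∣A² h) (A²∣2M h) (A²∣M² h) (nonmultiple-binomial p-prime β K (ℕᵈ.m∣m*n N)) (M∣binomial h)

  p^α-factor : ∀ p β N → p ℕ.* (p ℕ.^ β ℕ.* N) ≡ p ℕ.^ suc β ℕ.* N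
  p^α-factor p β N = sym (ℕₚ.*-assoc p (p ℕ.^ β) N)

  A²-cast : ∀ p β {x} → + (p ℕ.^ suc β) * + (p ℕ.^ suc β) ∣ x → + (p ℕ.^ (2 ℕ.* suc β)) ∣ x
  A²-cast p β {x} = subst (_∣ x) (trans (sym (pos-^-+ p (suc β) (suc β)))
    (cong (λ t → + (p ℕ.^ (suc β ℕ.+ t))) (sym (ℕₚ.+-identityʳ (suc β)))))

  cφ-congruence : ∀ p β N m a b → Prime p → Fin a ↔ CPhi (p ℕ.^ suc β ℕ.* N) (p ℕ.* m) →
    Fin b ↔ CPhi (p ℕ.^ β ℕ.* N) m → + (p ℕ.^ (2 ℕ.* suc β)) ∣ + a - + b
  cφ-congruence zero     β N m a b p-prime f g = contradiction p-prime ¬prime[0]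
  cφ-congruence (suc p₁) β N m a b p-prime f g with ∃-modulus p₁ β N p-prime
  ... | M , h = A²-cast (suc p₁) β (cφ.cφ-multiple p₁ β N p-prime M h m a b
    (subst (λ k → Fin a ↔ CPhi k (suc p₁ ℕ.* m)) (sym (p^α-factor (suc p₁) β N)) f) g)

  cφ-divisible : ∀ p β N n a → Prime p → ¬ (p ℕᵈ.∣ n) → Fin a ↔ CPhi (p ℕ.^ suc β ℕ.* N) n →
    + (p ℕ.^ (2 ℕ.* suc β)) ∣ + a
  cφ-divisible zero     β N n a p-prime p∤n f = contradiction p-prime ¬prime[0]
  cφ-divisible (suc p₁) β N n a p-prime p∤n f with ∃-modulus p₁ β N p-prime
  ... | M , h = A²-cast (suc p₁) β (cφ.cφ-nonmultiple p₁ β N p-prime M h n a p∤n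
    (subst (λ k → Fin a ↔ CPhi k n) (sym (p^α-factor (suc p₁) β N)) f))

open import Defs
open import Data.Nat using (ℕ; suc; s≤s; _≥_; _*_; _^_; _∸_)
open import Data.Nat.Divisibility using (_∣_)
open import Data.Nat.Primality using (Prime)
open import Data.Fin using (Fin)
open import Data.Product using (_×_; _,_)
open import Relation.Nullary using (¬_)
open import Function.Bundles using (_↔_)
open import Relation.Binary.PropositionalEquality using (_≡_; refl)
import Data.Integer as ℤ
import Data.Integer.Divisibility as ℤD
open import Data.Integer.Divisibility.Signed using (∣⇒∣ᵤ)
open Congruences using (cφ-congruence; cφ-divisible)

theorem5p3 : (p N α n : ℕ) → Prime p → ¬ (p ∣ N) → N ≥ 1 → α ≥ 1 →
    ((m : ℕ) → n ≡ p * m → (a b : ℕ) →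
    Fin a ↔ CPhi (p ^ α * N) n → Fin b ↔ CPhi (p ^ (α ∸ 1) * N) m →
    ℤ.+ (p ^ (2 * α)) ℤD.∣ (ℤ.+ a ℤ.- ℤ.+ b))
    × (¬ (p ∣ n) → (a : ℕ) → Fin a ↔ CPhi (p ^ α * N) n → p ^ (2 * α) ∣ a)
-- Matching on α ≥ 1 makes α = β + 1, so that α ∸ 1 reduces to β.
theorem5p3 p N (suc β) n p-prime _ _ (s≤s _) =
  (λ { m refl a b f g → ∣⇒∣ᵤ (cφ-congruence p β N m a b p-prime f g) }) ,
  (λ p∤n a f → ∣⇒∣ᵤ (cφ-divisible p β N n a p-prime p∤n f))
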